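{- There exists a function $f$ such that Fitting Hexasort can be decided, on an instance $(G,S,t)$ with color set $C$, in time $\mathcal{O}\bigl(f(|C|,t)\cdot|S|^2\bigr)$.
   Context: An instance $(G,S,t)$ of Hexasort consists of a finite simple undirected graph $G=(V,E)$, a threshold $t\in\mathbb{N}^+$, and a finite sequence $S$ of stacks with colors $C$; each stack $s=(c,h)\in S$ has a color $c\in C$ and a height $h\in\mathbb{N}^+$. A configuration is a function $\delta:V\to (C\times\mathbb{N}^+)\cup\{\perp\}$, where $\delta(v)=\perp$ means $v$ is empty and $\delta(v)=(c,h)$ means $v$ hosts a stack of color $c$ and height $h$. Initially $\delta(v)=\perp$ for all $v$. The stacks of $S$ are placed one after the other in the given order. To place the next stack $(c,h)$, the player chooses an empty vertex $x$; let $N_c[x]$ be the set of non-empty neighbors of $x$ hosting a stack of color $c$, and let $h'$ be the sum of their heights. The new configuration $\delta'$ is obtained from $\delta$ by setting $\delta'(u)=\perp$ for all $u\in N_c[x]$, and setting $\delta'(x)=\perp$ if $h+h'\ge t$ (the stacks vanish) and $\delta'(x)=(c,h+h')$ otherwise. Fitting Hexasort asks whether all stacks of $S$ can be placed in the given order (the vertices need not be empty afterwards). Standing assumption: $h\le t$ for all $(c,h)\in S$. -}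

module Defs where

open import Data.Bool.Base using (Bool; true; false; if_then_else_; _∧_)
open import Data.Fin.Base using (Fin; toℕ)
import Data.Fin.Properties as Fin
open import Data.List.Base using (List; []; _∷_; length; map; sum; tabulate; concat)
open import Data.List.Relation.Unary.All using (All)
open import Data.Maybe.Base using (Maybe; just; nothing; maybe′)
open import Data.Nat.Base using (ℕ; zero; suc; _+_; _∸_; _*_; _≤_; _⊔_; NonZero)
open import Data.Nat.Properties using (_≟_; _≤?_)
open import Data.Product.Base using (Σ-syntax; _×_; ∃-syntax)
open import Function.Bundles using (_⇔_)
open import Relation.Binary.PropositionalEquality.Core using (_≡_; _≢_)
open import Relation.Nullary.Decidable.Core using (does)

------------------------------------------------------------------------
-- Hexasort

record Graph (n : ℕ) : Set where
  field
    adj     : Fin n → Fin n → Bool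
    adj-sym : ∀ u v → adj u v ≡ adj v u
    no-loop : ∀ v → adj v v ≡ false

open Graph public

record Stack (k : ℕ) : Set where
  constructor stack
  field
    colour             : Fin k
    height             : ℕ
    .{{height-nonZero}} : NonZero height

open Stack public using (colour; height)

+-nonZeroˡ : ∀ m n → .{{NonZero m}} → NonZero (m + n)
+-nonZeroˡ (suc m) n = _

grow : ∀ {k} → Stack k → ℕ → Stack k
grow (stack c h) h′ = stack c (h + h′) {{+-nonZeroˡ h h′}}

-- nothing is the empty vertex ⊥.
Config : ℕ → ℕ → Set
Config n k = Fin n → Maybe (Stack k)

module _ {n k : ℕ} where

  emptyConfig : Config n k
  emptyConfig _ = nothing

  hasColour : Fin k → Maybe (Stack k) → Bool
  hasColour c = maybe′ (λ s → does (colour s Fin.≟ c)) false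

  heightAt : Config n k → Fin n → ℕ
  heightAt δ v = maybe′ height 0 (δ v)

  -- Membership of u in N_c[x].
  sameColourNeighbour : Graph n → Config n k → Fin k → Fin n → Fin n → Bool
  sameColourNeighbour G δ c x u = adj G x u ∧ hasColour c (δ u)

  collectedHeight : Graph n → Config n k → Fin k → Fin n → ℕ
  collectedHeight G δ c x =
    sum (tabulate λ u → if sameColourNeighbour G δ c x u then heightAt δ u else 0)

  place : Graph n → ℕ → Config n k → Fin n → Stack k → Config n k
  place G t δ x s v =
    if does (v Fin.≟ x)
    then (if does (t ≤? height s + h′) then nothing else just (grow s h′))
    else (if sameColourNeighbour G δ (colour s) x v then nothing else δ v)
    where
    h′ = collectedHeight G δ (colour s) x

  data Placeable (G : Graph n) (t : ℕ) : Config n k → List (Stack k) → Set where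
    done : ∀ {δ} → Placeable G t δ []
    next : ∀ {δ s S} x → δ x ≡ nothing →
           Placeable G t (place G t δ x s) S → Placeable G t δ (s ∷ S)

record Instance : Set where
  field
    numVertices : ℕ
    graph       : Graph numVertices
    numColours  : ℕ
    threshold   : ℕ
    {{threshold-nonZero}} : NonZero threshold
    stacks      : List (Stack numColours)
    heights≤threshold : All (λ s → height s ≤ threshold) stacks

open Instance public

FittingHexasort : Instance → Set
FittingHexasort I = Placeable (graph I) (threshold I) emptyConfig (stacks I)

------------------------------------------------------------------------
-- Random access machines with uniform cost.  A program mentions only
-- finitely many variables and arrays; interleaving the arrays in a single
-- memory changes running times by a constant factor only (depending on the
-- program).  As usual for uniform cost, multiplication is not an instruction.

data Expr : Set where
  lit     : ℕ → Expr
  var     : ℕ → Expr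
  _⟦_⟧    : ℕ → Expr → Expr
  _⊕_ _⊖_ : Expr → Expr → Expr

infix  9 _⟦_⟧
infixl 6 _⊕_ _⊖_

data Program : Set where
  skip    : Program
  _≔_     : ℕ → Expr → Program
  _⟦_⟧≔_  : ℕ → Expr → Expr → Program
  _⨾_     : Program → Program → Program
  if≢0    : Expr → Program → Program → Program
  while≢0 : Expr → Program → Program

infix  4 _≔_ _⟦_⟧≔_
infixr 3 _⨾_

record State : Set where
  constructor state
  field
    vars   : ℕ → ℕ
    arrays : ℕ → ℕ → ℕ

open State public

_[_↦_] : {A : Set} → (ℕ → A) → ℕ → A → ℕ → A
(f [ i ↦ a ]) j = if does (j ≟ i) then a else f j

setVar : State → ℕ → ℕ → State
setVar (state ρ α) x a = state (ρ [ x ↦ a ]) α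

setCell : State → ℕ → ℕ → ℕ → State
setCell (state ρ α) A i a = state ρ (α [ A ↦ α A [ i ↦ a ] ])

eval : State → Expr → ℕ
eval σ (lit a)   = a
eval σ (var x)   = vars σ x
eval σ (A ⟦ e ⟧) = arrays σ A (eval σ e)
eval σ (d ⊕ e)   = eval σ d + eval σ e
eval σ (d ⊖ e)   = eval σ d ∸ eval σ e

cost : Expr → ℕ
cost (lit _)   = 1
cost (var _)   = 1
cost (_ ⟦ e ⟧) = 1 + cost e
cost (d ⊕ e)   = 1 + cost d + cost e
cost (d ⊖ e)   = 1 + cost d + cost e

-- ⟨ P , σ ⟩⇓⟨ τ , m ⟩: started in σ, P halts in τ after m steps.
data ⟨_,_⟩⇓⟨_,_⟩ : Program → State → State → ℕ → Set where

  ⇓skip : ∀ {σ} → ⟨ skip , σ ⟩⇓⟨ σ , 1 ⟩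

  ⇓var : ∀ {σ x e} →
    ⟨ x ≔ e , σ ⟩⇓⟨ setVar σ x (eval σ e) , 1 + cost e ⟩

  ⇓cell : ∀ {σ A d e} →
    ⟨ A ⟦ d ⟧≔ e , σ ⟩⇓⟨ setCell σ A (eval σ d) (eval σ e) , 1 + cost d + cost e ⟩

  ⇓seq : ∀ {σ τ υ P Q l m} →
    ⟨ P , σ ⟩⇓⟨ τ , l ⟩ → ⟨ Q , τ ⟩⇓⟨ υ , m ⟩ → ⟨ P ⨾ Q , σ ⟩⇓⟨ υ , l + m ⟩

  ⇓then : ∀ {σ τ e P Q m} → eval σ e ≢ 0 →
    ⟨ P , σ ⟩⇓⟨ τ , m ⟩ → ⟨ if≢0 e P Q , σ ⟩⇓⟨ τ , 1 + cost e + m ⟩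

  ⇓else : ∀ {σ τ e P Q m} → eval σ e ≡ 0 →
    ⟨ Q , σ ⟩⇓⟨ τ , m ⟩ → ⟨ if≢0 e P Q , σ ⟩⇓⟨ τ , 1 + cost e + m ⟩

  ⇓stop : ∀ {σ e P} → eval σ e ≡ 0 →
    ⟨ while≢0 e P , σ ⟩⇓⟨ σ , 1 + cost e ⟩

  ⇓loop : ∀ {σ τ υ e P l m} → eval σ e ≢ 0 →
    ⟨ P , σ ⟩⇓⟨ τ , l ⟩ → ⟨ while≢0 e P , τ ⟩⇓⟨ υ , m ⟩ →
    ⟨ while≢0 e P , σ ⟩⇓⟨ υ , 1 + cost e + l + m ⟩

------------------------------------------------------------------------
-- Deciding problems on Hexasort instances

nth : {A : Set} → A → List A → ℕ → A
nth d []       _       = d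
nth d (a ∷ _)  zero    = a
nth d (_ ∷ as) (suc i) = nth d as i

-- The adjacency matrix in row-major order.
adjacencyMatrix : ∀ {n} → Graph n → List ℕ
adjacencyMatrix G =
  concat (tabulate λ u → tabulate λ v → if adj G u v then 1 else 0)

-- Variables and arrays not holding input are zero.
input : Instance → State
input I = state
  (nth 0 (numVertices I ∷ numColours I ∷ threshold I ∷ length (stacks I) ∷ []))
  (nth (λ _ → 0) (map (nth 0)
    ( map (λ s → toℕ (colour s)) (stacks I)
    ∷ map height (stacks I)
    ∷ adjacencyMatrix (graph I)
    ∷ [])))

Accepting : State → Set
Accepting σ = vars σ 0 ≢ 0

-- One program works for all instances.  The maximum with 1 only matters
-- where g vanishes: no program halts in zero steps.
DecidableInTimeO : (Instance → Set) → (Instance → ℕ) → Set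
DecidableInTimeO Q g =
  Σ[ P ∈ Program ] ∃[ c ] ∀ (I : Instance) →
    ∃[ τ ] ∃[ m ] ⟨ P , input I ⟩⇓⟨ τ , m ⟩
                × (Accepting τ ⇔ Q I)
                × m ≤ c * (1 ⊔ g I)

{-# OPTIONS --safe #-}
module Submission where

-- If the stacks are not more numerous than the vertices, put each on its own
-- vertex.  Otherwise there are fewer than |S| vertices, and the adjacency matrix
-- can be read in time O(|S|²).  A matching with an edge for every colour always
-- suffices: each colour keeps to its edge and merges with what it left there.
-- So does a vertex with |C| t neighbours: reserve t of them for each colour, and
-- once they are occupied the next stack of that colour vanishes on the centre.
-- If neither exists, the closed neighbourhoods of the ends of a maximal matching
-- contain all non-isolated vertices, which number at most 2 |C|² t; these form
-- the kernel.  Isolated vertices only ever hold one stack each, so for a kernel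
-- configuration it only matters how many of them a suffix of S requires.  This
-- number is computed for all configurations, suffix by suffix, starting from the
-- empty one.

open import Defs
import Data.Bool.Properties as Bool
import Data.Fin.Properties as Fin
import Data.List.Membership.DecPropositional as DecMembership
import Data.List.Base as List
import Data.List.Relation.Unary.All as ListAll
import Data.List.Relation.Unary.Unique.Propositional.Properties as Unique
open import Data.Bool.Base using (Bool; true; false; not; if_then_else_; _∧_)
open import Data.Bool.Properties using (∧-zeroʳ)
open import Data.Empty using (⊥)
open import Data.Fin.Base using (Fin; zero; suc; toℕ; fromℕ<; inject≤; combine; remQuot)
open import Data.Fin using (#_)
open import Data.List.Base using (List; []; _∷_; _++_; length; map; tabulate; concat; drop; filter; allFin)
open import Data.List.Membership.Propositional using (_∈_; _∉_)
open import Data.List.Membership.Propositional.Properties using (∈-filter⁺; ∈-filter⁻; ∈-allFin; ∈-lookup; ∈-++⁺ˡ; ∈-++⁺ʳ)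
open import Data.List.Properties using (length-++; length-tabulate; tabulate-cong; drop-all)
open import Data.List.Relation.Unary.All using (_∷_)
open import Data.List.Relation.Unary.AllPairs using (_∷_)
open import Data.List.Relation.Unary.Any using (here; there; index)
open import Data.List.Relation.Unary.Any.Properties using (lookup-index)
open import Data.List.Relation.Unary.Unique.Propositional using (Unique)
open import Data.Maybe.Base using (Maybe; just; nothing; maybe′)
open import Data.Maybe.Relation.Unary.All using (All; just; nothing; drop-just)
open import Data.Nat.Base
open import Data.Nat.ListAction using (sum)
open import Data.Nat.Properties
open import Data.Product.Base hiding (map)
open import Data.Sum.Base using (_⊎_; inj₁; inj₂)
open import Data.Vec.Base using (Vec; []; _∷_; lookup)
open import Function.Base using (id; _∘_; _$_)
open import Function.Bundles using (_⇔_; mk⇔; Equivalence)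
open import Function.Definitions using (Injective)
open import Relation.Binary.Definitions using (tri<; tri≈; tri>)
open import Relation.Binary.PropositionalEquality
open import Relation.Nullary.Decidable using (Dec; yes; no; does; dec-true; dec-false; ¬?)
open import Relation.Nullary.Negation using (contradiction)
open import Algebra.Properties.CommutativeSemigroup +-commutativeSemigroup using (x∙yz≈y∙xz)

-- Time-bounded execution

-- The obstacle is the running time: a table entry may cost only an amount depending on |C| and t,
-- although vertex numbers grow with |S| and the machine multiplies by repeated addition. Hence
-- kernel vertices are addressed by their index in a list, and everything computed from codes is a
-- term in a small language of primitive recursion, in which any bound on the arguments yields
-- bounds on values and time. Access to the graph is confined to an edge test with answer 0 or 1, so
-- the graph does not enter these bounds. Colours are less than |C|, indices and codes are bounded
-- through the size of the kernel, and the assumption that no height exceeds t bounds the remaining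
-- argument. The function f is assembled from these bounds rather than given by a formula. Beyond
-- it, |S| enters only through the scan of the matrix, at most |S|² cells, and the loop over the |S|
-- stages.

update-same : ∀ {A : Set} (f : ℕ → A) i a → (f [ i ↦ a ]) i ≡ a
update-same f i a = cong (if_then a else f i) (dec-true (i ≟ i) refl)

update-other : ∀ {A : Set} (f : ℕ → A) {i j} a → j ≢ i → (f [ i ↦ a ]) j ≡ f j
update-other f {i} {j} a j≢i = cong (if_then a else f j) (dec-false (j ≟ i) j≢i)

-- A Hoare triple for total correctness. Time is only bounded from above, so different branches and
-- rounds can share one bound.
record Terminates (P : Program) (σ : State) (Q : State → Set) (T : ℕ) : Set where
  constructor terminates
  field
    {final} : State
    {steps} : ℕ
    run     : ⟨ P , σ ⟩⇓⟨ final , steps ⟩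
    post    : Q final
    bound   : steps ≤ T

weaken : ∀ {P σ Q R T U} → (∀ {τ} → Q τ → R τ) → T ≤ U →
         Terminates P σ Q T → Terminates P σ R U
weaken Q⇒R T≤U (terminates r q b) = terminates r (Q⇒R q) (≤-trans b T≤U)

skip-t : ∀ {σ Q} → Q σ → Terminates skip σ Q 1
skip-t q = terminates ⇓skip q ≤-refl

assign : ∀ {σ Q x e} → Q (setVar σ x (eval σ e)) → Terminates (x ≔ e) σ Q (1 + cost e)
assign q = terminates ⇓var q ≤-refl

store : ∀ {σ Q A d e} → Q (setCell σ A (eval σ d) (eval σ e)) →
        Terminates (A ⟦ d ⟧≔ e) σ Q (1 + cost d + cost e)
store q = terminates ⇓cell q ≤-refl

infixr 3 _then_

_then_ : ∀ {P P′ σ Q R T U} → Terminates P σ Q T →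
         (∀ {τ} → Q τ → Terminates P′ τ R U) → Terminates (P ⨾ P′) σ R (T + U)
terminates r q b then k =
  let terminates r′ q′ b′ = k q in terminates (⇓seq r r′) q′ (+-mono-≤ b b′)

branch : ∀ {P P′ σ Q e T U} →
         (eval σ e ≢ 0 → Terminates P σ Q T) → (eval σ e ≡ 0 → Terminates P′ σ Q U) →
         Terminates (if≢0 e P P′) σ Q (1 + cost e + (T + U))
branch {σ = σ} {e = e} {T} {U} onTrue onFalse with eval σ e in eq
... | zero  = let terminates r q b = onFalse refl in
  terminates (⇓else eq r) q (+-monoʳ-≤ (1 + cost e) (≤-trans b (m≤n+m U T)))
... | suc _ = let terminates r q b = onTrue (λ ()) in
  terminates (⇓then (λ z → 1+n≢0 (trans (sym eq) z)) r) q
    (+-monoʳ-≤ (1 + cost e) (≤-trans b (m≤m+n T U)))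

-- With `lit 1` on the left, the increment evaluates to a successor by computation.
for : ℕ → ℕ → Program → Program
for x l P = x ≔ lit 0 ⨾ while≢0 (var l ⊖ var x) (P ⨾ x ≔ lit 1 ⊕ var x)

-- Clearing the counter takes 2 steps and the failing test 4; each round adds 4 for its test and 4
-- for the increment.
forCost : ℕ → ℕ → ℕ
forCost k T = 2 + (4 + k * (4 + (T + 4)))

module _ {x l k T : ℕ} {P : Program} (x≢l : l ≢ x) (Inv : ℕ → State → Set)
         (body : ∀ {i σ} → i < k → vars σ x ≡ i → vars σ l ≡ k → Inv i σ →
           Terminates P σ
             (λ τ → vars τ x ≡ i × vars τ l ≡ k × Inv (suc i) (setVar τ x (suc i))) T)
  where

  private
    loop : ∀ j i {σ} → j + i ≡ k → vars σ x ≡ i → vars σ l ≡ k → Inv i σ →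
      Terminates (while≢0 (var l ⊖ var x) (P ⨾ x ≔ lit 1 ⊕ var x)) σ (Inv k)
        (4 + j * (4 + (T + 4)))
    loop zero i refl ex el inv =
      terminates (⇓stop (trans (cong₂ _∸_ el ex) (n∸n≡0 i))) inv ≤-refl
    loop (suc j) i refl ex el inv =
      let terminates {τ} r (ex′ , el′ , inv′) b = body (m<1+n+m i j) ex el inv
          terminates r″ q b″ = loop j (suc i) (+-suc j i)
            (trans (update-same (vars τ) x _) (cong suc ex′))
            (trans (update-other (vars τ) _ x≢l) el′)
            (subst (λ a → Inv (suc i) (setVar τ x (suc a))) (sym ex′) inv′)
      in terminates
           (⇓loop (λ z → m>n⇒m∸n≢0 (m<1+n+m i j) (trans (sym (cong₂ _∸_ el ex)) z))
             (⇓seq r ⇓var) r″) q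
           (≤-trans (+-mono-≤ (+-monoʳ-≤ 4 (+-monoˡ-≤ 4 b)) b″)
             (≤-reflexive (trans (sym (+-assoc (4 + (T + 4)) 4 _))
               (trans (cong (_+ j * (4 + (T + 4))) (+-comm (4 + (T + 4)) 4)) (+-assoc 4 (4 + (T + 4)) _)))))
      where
      m<1+n+m : ∀ m n → m < suc n + m
      m<1+n+m m n = s≤s (m≤n+m m n)

  for-t : ∀ {σ} → vars σ l ≡ k → Inv 0 (setVar σ x 0) →
          Terminates (for x l P) σ (Inv k) (forCost k T)
  for-t {σ} el inv = assign {Q = λ τ → vars τ x ≡ 0 × vars τ l ≡ k × Inv 0 τ}
      (update-same (vars σ) x 0 , trans (update-other (vars σ) 0 x≢l) el , inv)
    then λ (ex , el , inv) → loop k 0 (+-identityʳ k) ex el inv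

-- Compiling primitive recursive terms

data Op : Set where
  plus monus edge : Op

infixl 8 _·_

data Term (n : ℕ) : Set
data Terms (n : ℕ) : ℕ → Set

data Term n where
  var : Fin n → Term n
  lit : ℕ → Term n
  bin : Op → Term n → Term n → Term n
  rec : Term n → Term n → Term (2 + n) → Term n
  _·_ : ∀ {k} → Term k → Terms n k → Term n

data Terms n where
  []  : Terms n 0
  _∷_ : ∀ {k} → Term n → Terms n k → Terms n (suc k)

fold : {A : Set} → ℕ → A → (ℕ → A → A) → A
fold zero    z s = z
fold (suc k) z s = s k (fold k z s)

module Semantics (O : ℕ → ℕ → ℕ) where

  apply : Op → ℕ → ℕ → ℕ
  apply plus  a b = a + b
  apply monus a b = a ∸ b
  -- Even at arguments outside the kernel, where `O` reads arbitrary cells, the result is at most 1,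
  -- so `apply≤` holds for every `O`.
  apply edge  a b = 1 ∸ (1 ∸ O a b)

  ⟦_⟧  : ∀ {n} → Term n → Vec ℕ n → ℕ
  ⟦_⟧* : ∀ {n k} → Terms n k → Vec ℕ n → Vec ℕ k

  ⟦ var i ⟧     vs = lookup vs i
  ⟦ lit a ⟧     vs = a
  ⟦ bin o t u ⟧ vs = apply o (⟦ t ⟧ vs) (⟦ u ⟧ vs)
  ⟦ rec k z s ⟧ vs = fold (⟦ k ⟧ vs) (⟦ z ⟧ vs) (λ i a → ⟦ s ⟧ (i ∷ a ∷ vs))
  ⟦ f · ts ⟧    vs = ⟦ f ⟧ (⟦ ts ⟧* vs)

  ⟦ [] ⟧*     vs = []
  ⟦ t ∷ ts ⟧* vs = ⟦ t ⟧ vs ∷ ⟦ ts ⟧* vs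

opExpr : Op → Expr → Expr → Expr
opExpr plus  d e = d ⊕ e
opExpr monus d e = d ⊖ e
opExpr edge  d e = lit 1 ⊖ (lit 1 ⊖ 2 ⟦ 3 ⟦ d ⟧ ⊕ 4 ⟦ e ⟧ ⟧)

block : ℕ → (k : ℕ) → Vec ℕ k
block r zero    = []
block r (suc k) = r ∷ block (suc r) k

-- compile t rs r leaves the value of t, whose arguments are in the registers
-- rs, in register r and clobbers no register below r.
compile  : ∀ {n} → Term n → Vec ℕ n → ℕ → Program
compile* : ∀ {n k} → Terms n k → Vec ℕ n → ℕ → Program

compile (var i)         rs r = r ≔ var (lookup rs i)
compile (lit a)         rs r = r ≔ lit a
compile (bin o t u)     rs r =
  compile t rs r ⨾ compile u rs (1 + r) ⨾ r ≔ opExpr o (var r) (var (1 + r))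
compile (rec k z s)     rs r =
  compile z rs r ⨾ compile k rs (1 + r) ⨾
  for (2 + r) (1 + r) (compile s (2 + r ∷ r ∷ rs) (3 + r) ⨾ r ≔ var (3 + r))
compile (_·_ {k} f ts)  rs r =
  compile* ts rs r ⨾ compile f (block r k) (k + r) ⨾ r ≔ var (k + r)

compile* []       rs r = skip
compile* (t ∷ ts) rs r = compile t rs r ⨾ compile* ts rs (suc r)

valueBound  : ∀ {n} → Term n → ℕ → ℕ
valueBound* : ∀ {n k} → Terms n k → ℕ → ℕ
-- Each round adds to the previous bound instead of replacing it. The bounds thus increase with the
-- number of rounds by construction, and the last one serves for all rounds.
accBound    : ∀ {n} → Term (2 + n) → ℕ → ℕ → ℕ → ℕ

valueBound (var i)     N = N
valueBound (lit a)     N = a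
valueBound (bin o t u) N = 1 + (valueBound t N + valueBound u N)
valueBound (rec k z s) N = accBound s (N + valueBound k N) (valueBound z N) (valueBound k N)
valueBound (f · ts)    N = valueBound f (valueBound* ts N)

valueBound* []       N = 0
valueBound* (t ∷ ts) N = valueBound t N + valueBound* ts N

accBound s N z zero    = z
accBound s N z (suc i) = accBound s N z i + valueBound s (N + accBound s N z i)

-- Opaque, since evaluating the bounds on the terms below is infeasible.
opaque

  costBound  : ∀ {n} → Term n → ℕ → ℕ
  costBound* : ∀ {n k} → Terms n k → ℕ → ℕ

  costBound (var i)     N = 2
  costBound (lit a)     N = 2
  costBound (bin o t u) N = costBound t N + (costBound u N + 11)
  costBound (rec k z s) N = costBound z N + (costBound k N +
    forCost (valueBound k N) (costBound s (N + valueBound k N + valueBound (rec k z s) N) + 2))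
  costBound (f · ts)    N = costBound* ts N + (costBound f (valueBound* ts N) + 2)

  costBound* []       N = 1
  costBound* (t ∷ ts) N = costBound t N + costBound* ts N

accBound-mono : ∀ {n} (s : Term (2 + n)) N z {i j} → i ≤ j → accBound s N z i ≤ accBound s N z j
accBound-mono s N z {j = zero}  z≤n = ≤-refl
accBound-mono s N z {i} {suc j} i≤1+j with m≤n⇒m<n∨m≡n i≤1+j
... | inj₁ (s≤s i≤j) = ≤-trans (accBound-mono s N z i≤j) (m≤m+n _ _)
... | inj₂ refl      = ≤-refl

forCost-monoˡ : ∀ {j k} T → j ≤ k → forCost j T ≤ forCost k T
forCost-monoˡ T j≤k = +-monoʳ-≤ 6 (*-monoˡ-≤ (4 + (T + 4)) j≤k)

infix 4 _≤*_

record _≤*_ {n : ℕ} (vs : Vec ℕ n) (N : ℕ) : Set where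
  constructor bounded
  field
    lookup≤ : ∀ i → lookup vs i ≤ N

open _≤*_ public

[]≤* : ∀ {N} → [] ≤* N
[]≤* = bounded λ ()

≤*-∷ : ∀ {n a N} {vs : Vec ℕ n} → a ≤ N → vs ≤* N → a ∷ vs ≤* N
≤*-∷ a≤N (bounded vs≤N) = bounded λ where
  zero    → a≤N
  (suc i) → vs≤N i

≤*-trans : ∀ {n M N} {vs : Vec ℕ n} → vs ≤* M → M ≤ N → vs ≤* N
≤*-trans (bounded vs≤M) M≤N = bounded λ i → ≤-trans (vs≤M i) M≤N

module _ (O : ℕ → ℕ → ℕ) where
  open Semantics O

  apply≤ : ∀ o a b → apply o a b ≤ 1 + (a + b)
  apply≤ plus  a b = n≤1+n (a + b)
  apply≤ monus a b = ≤-trans (m∸n≤m a b) (≤-trans (m≤m+n a b) (n≤1+n (a + b)))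
  apply≤ edge  a b = ≤-trans (m∸n≤m 1 (1 ∸ O a b)) (s≤s z≤n)

  value≤  : ∀ {n} (t : Term n) {vs N} → vs ≤* N → ⟦ t ⟧ vs ≤ valueBound t N
  value*≤ : ∀ {n k} (ts : Terms n k) {vs N} → vs ≤* N → ⟦ ts ⟧* vs ≤* valueBound* ts N
  acc≤    : ∀ {n} (s : Term (2 + n)) {vs N a z} L i → vs ≤* N → a ≤ z → i ≤ L →
            fold i a (λ i a → ⟦ s ⟧ (i ∷ a ∷ vs)) ≤ accBound s (N + L) z i

  value≤ (var i)     vs≤N = lookup≤ vs≤N i
  value≤ (lit a)     vs≤N = ≤-refl
  value≤ (bin o t u) vs≤N =
    ≤-trans (apply≤ o _ _) (s≤s (+-mono-≤ (value≤ t vs≤N) (value≤ u vs≤N)))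
  value≤ (rec k z s) {vs} {N} vs≤N =
    ≤-trans (acc≤ s (valueBound k N) (⟦ k ⟧ vs) vs≤N (value≤ z vs≤N) (value≤ k vs≤N))
            (accBound-mono s _ _ (value≤ k vs≤N))
  value≤ (f · ts)    vs≤N = value≤ f (value*≤ ts vs≤N)

  value*≤ []       vs≤N = []≤*
  value*≤ (t ∷ ts) vs≤N = ≤*-∷ (≤-trans (value≤ t vs≤N) (m≤m+n _ _))
                               (≤*-trans (value*≤ ts vs≤N) (m≤n+m _ _))

  acc≤ s L zero    vs≤N a≤z i≤L = a≤z
  acc≤ s {N = N} L (suc i) vs≤N a≤z i<L =
    let IH = acc≤ s L i vs≤N a≤z (<⇒≤ i<L)
    in ≤-trans (value≤ s (≤*-∷ (≤-trans (<⇒≤ i<L) (≤-trans (m≤n+m L N) (m≤m+n _ _)))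
                         (≤*-∷ (≤-trans IH (m≤n+m _ _))
                               (≤*-trans vs≤N (≤-trans (m≤m+n N L) (m≤m+n _ _))))))
               (m≤n+m _ _)

  HoldsEdges : State → Set
  HoldsEdges σ = ∀ a b → arrays σ 2 (arrays σ 3 a + arrays σ 4 b) ≡ O a b

  eval-opExpr : ∀ o d e σ → HoldsEdges σ → eval σ (opExpr o d e) ≡ apply o (eval σ d) (eval σ e)
  eval-opExpr plus  d e σ E = refl
  eval-opExpr monus d e σ E = refl
  eval-opExpr edge  d e σ E = cong (λ a → 1 ∸ (1 ∸ a)) (E (eval σ d) (eval σ e))

  cost-opExpr : ∀ o q r → 1 + cost (opExpr o (var q) (var r)) ≤ 11
  cost-opExpr plus  q r = m≤m+n 4 7
  cost-opExpr monus q r = m≤m+n 4 7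
  cost-opExpr edge  q r = ≤-refl

  record Holds {n : ℕ} (σ : State) (rs vs : Vec ℕ n) (r : ℕ) : Set where
    constructor holds
    field
      held : ∀ i → lookup rs i < r × vars σ (lookup rs i) ≡ lookup vs i

  open Holds public

  record SameBelow (r : ℕ) (σ τ : State) : Set where
    constructor sameBelow
    field
      sameVars   : ∀ {q} → q < r → vars τ q ≡ vars σ q
      sameArrays : arrays τ ≡ arrays σ

  open SameBelow public

  Returns : ℕ → ℕ → State → State → Set
  Returns a r σ τ = vars τ r ≡ a × SameBelow r σ τ

  same-trans : ∀ {r σ τ υ} → SameBelow r σ τ → SameBelow r τ υ → SameBelow r σ υ
  same-trans (sameBelow v a) (sameBelow v′ a′) =
    sameBelow (λ q<r → trans (v′ q<r) (v q<r)) (trans a′ a)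

  same-weaken : ∀ {q r σ τ} → q ≤ r → SameBelow r σ τ → SameBelow q σ τ
  same-weaken q≤r (sameBelow v a) = sameBelow (λ p<q → v (<-≤-trans p<q q≤r)) a

  same-set : ∀ {r q} σ a → r ≤ q → SameBelow r σ (setVar σ q a)
  same-set σ a r≤q = sameBelow (λ p<r → update-other (vars σ) a (<⇒≢ (<-≤-trans p<r r≤q))) refl

  edges-same : ∀ {r σ τ} → HoldsEdges σ → SameBelow r σ τ → HoldsEdges τ
  edges-same E (sameBelow _ refl) = E

  holds-same : ∀ {n σ τ q r} {rs vs : Vec ℕ n} → q ≤ r → SameBelow q σ τ →
               Holds σ rs vs q → Holds τ rs vs r
  holds-same q≤r s (holds H) = holds λ i → let r<q , e = H i in <-≤-trans r<q q≤r , trans (sameVars s r<q) e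

  holds-[] : ∀ {σ r} → Holds σ [] [] r
  holds-[] = holds λ ()

  holds-∷ : ∀ {n σ r q a} {rs vs : Vec ℕ n} → q < r → vars σ q ≡ a →
            Holds σ rs vs r → Holds σ (q ∷ rs) (a ∷ vs) r
  holds-∷ q<r e (holds H) = holds λ where
    zero    → q<r , e
    (suc i) → H i

  opaque
    unfolding costBound

    compute  : ∀ {n} (t : Term n) {rs vs r N σ} → HoldsEdges σ → Holds σ rs vs r → vs ≤* N →
               Terminates (compile t rs r) σ (Returns (⟦ t ⟧ vs) r σ) (costBound t N)
    compute* : ∀ {n k} (ts : Terms n k) {rs vs r N σ} → HoldsEdges σ → Holds σ rs vs r → vs ≤* N →
               Terminates (compile* ts rs r) σ
                 (λ τ → Holds τ (block r k) (⟦ ts ⟧* vs) (k + r) × SameBelow r σ τ) (costBound* ts N)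

    compute (var i) {r = r} {σ = σ} E H b =
      assign (trans (update-same (vars σ) r _) (proj₂ (held H i)) , same-set σ _ ≤-refl)
    compute (lit a) {r = r} {σ = σ} E H b =
      assign (update-same (vars σ) r _ , same-set σ _ ≤-refl)
    compute (bin o t u) {r = r} {σ = σ} E H b =
      compute t E H b then λ {τ} (et , s) →
      compute u (edges-same E s) (holds-same (n≤1+n r) s H) b then λ {υ} (eu , s′) →
      weaken (λ p → p) (cost-opExpr o r (1 + r)) (assign
        ( trans (update-same (vars υ) r _)
            (trans (eval-opExpr o (var r) (var (1 + r)) υ (edges-same (edges-same E s) s′))
                   (cong₂ (apply o) (trans (sameVars s′ ≤-refl) et) eu))
        , same-trans (same-trans s (same-weaken (n≤1+n r) s′)) (same-set υ _ ≤-refl)))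
    compute (rec k z s) {rs} {vs} {r} {N} {σ} E H b =
      compute z E H b then λ {τ} (ez , s₁) →
      compute k (edges-same E s₁) (holds-same (n≤1+n r) s₁ H) b then λ {υ} (ek , s₂) →
      weaken (λ (e , s₃) → e , s₃) (forCost-monoˡ _ (value≤ k b))
        (for-t {x = 2 + r} {l = 1 + r} (λ ()) Inv body ek
          ( trans (update-other (vars υ) {2 + r} {r} 0 (λ ())) (trans (sameVars s₂ ≤-refl) ez)
          , same-trans (same-trans s₁ (same-weaken (n≤1+n r) s₂)) (same-set υ 0 (m≤n+m r 2)) ))
      where
      acc : ℕ → ℕ
      acc i = fold i (⟦ z ⟧ vs) (λ i a → ⟦ s ⟧ (i ∷ a ∷ vs))

      Inv : ℕ → State → Set
      Inv i = Returns (acc i) r σ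

      body : ∀ {i υ} → i < ⟦ k ⟧ vs → vars υ (2 + r) ≡ i → vars υ (1 + r) ≡ ⟦ k ⟧ vs → Inv i υ →
        Terminates (compile s (2 + r ∷ r ∷ rs) (3 + r) ⨾ r ≔ var (3 + r)) υ
          (λ τ → vars τ (2 + r) ≡ i × vars τ (1 + r) ≡ ⟦ k ⟧ vs ×
                 Inv (suc i) (setVar τ (2 + r) (suc i)))
          (costBound s (N + valueBound k N + valueBound (rec k z s) N) + 2)
      body {i} {υ} i<k ei ek (ea , s₁) =
        compute s (edges-same E s₁)
          (holds-∷ ≤-refl ei (holds-∷ (m<n+m r (s≤s z≤n)) ea (holds-same (m≤n+m r 3) s₁ H)))
          -- Counter, accumulator and arguments are covered by different summands of one bound, so
          -- all rounds get the same time.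
          (≤*-∷ (≤-trans (<⇒≤ i<k) (≤-trans (value≤ k b) (≤-trans (m≤n+m _ N) (m≤m+n _ _))))
          (≤*-∷ (≤-trans (acc≤ s (valueBound k N) i b (value≤ z b) (<⇒≤ (<-≤-trans i<k (value≤ k b))))
                  (≤-trans (accBound-mono s _ _ (<⇒≤ (<-≤-trans i<k (value≤ k b)))) (m≤n+m _ _)))
                (≤*-trans b (≤-trans (m≤m+n N _) (m≤m+n _ _)))))
        then λ {τ} (e , s₂) → assign
          ( trans (update-other (vars τ) {r} {2 + r} _ (λ ())) (trans (sameVars s₂ ≤-refl) ei)
          , trans (update-other (vars τ) {r} {1 + r} _ (λ ())) (trans (sameVars s₂ (n≤1+n (2 + r))) ek)
          , trans (update-other (vars (setVar τ r _)) {2 + r} {r} _ (λ ())) (trans (update-same (vars τ) r _) e)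
          , same-trans (same-trans s₁ (same-weaken (m≤n+m r 3) s₂))
              (same-trans (same-set τ _ ≤-refl) (same-set (setVar τ r _) _ (m≤n+m r 2))))
    compute (_·_ {k} f ts) {r = r} {σ = σ} E H b =
      compute* ts E H b then λ {τ} (Hs , s) →
      compute f (edges-same E s) Hs (value*≤ ts b) then λ {υ} (e , s′) →
      assign ( trans (update-same (vars υ) r _) e
             , same-trans (same-trans s (same-weaken (m≤n+m r k) s′)) (same-set υ _ ≤-refl))

    compute* []       E H b = skip-t (holds-[] , sameBelow (λ _ → refl) refl)
    compute* {k = suc k} (t ∷ ts) {r = r} E H b =
      compute t E H b then λ {τ} (e , s) →
      weaken (λ {υ} (Hs , s′) →
          subst (Holds υ (r ∷ block (suc r) k) _) (+-suc k r)
            (holds-∷ (s≤s′ k) (trans (sameVars s′ ≤-refl) e) Hs)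
          , same-trans s (same-weaken (n≤1+n r) s′))
        ≤-refl
        (compute* ts (edges-same E s) (holds-same (n≤1+n r) s H) b)
      where
      s≤s′ : ∀ k → r < k + suc r
      s≤s′ k = m≤n+m (suc r) k

-- Instances in which all stacks can be placed

if-true : ∀ {A : Set} {b} {x y : A} → b ≡ true → (if b then x else y) ≡ x
if-true refl = refl

if-false : ∀ {A : Set} {b} {x y : A} → b ≡ false → (if b then x else y) ≡ y
if-false refl = refl

-- This form avoids subtraction. It serves to split off a summand and to follow `freeCount` when an
-- isolated vertex is used.
sum-exchange : ∀ {n} (f g : Fin n → ℕ) x → (∀ v → v ≢ x → f v ≡ g v) →
               f x + sum (tabulate g) ≡ g x + sum (tabulate f)
sum-exchange {suc n} f g zero    f≈g =
  trans (x∙yz≈y∙xz (f zero) (g zero) _) (cong (λ a → g zero + (f zero + sum a))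
    (sym (tabulate-cong λ v → f≈g (suc v) λ ())))
sum-exchange {suc n} f g (suc x) f≈g = begin
  f (suc x) + (g zero + sum (tabulate (g ∘ suc)))
    ≡⟨ x∙yz≈y∙xz (f (suc x)) (g zero) _ ⟩
  g zero + (f (suc x) + sum (tabulate (g ∘ suc)))
    ≡⟨ cong₂ _+_ (sym (f≈g zero λ ()))
         (sum-exchange (f ∘ suc) (g ∘ suc) x λ v v≢x → f≈g (suc v) (v≢x ∘ Fin.suc-injective)) ⟩
  f zero + (g (suc x) + sum (tabulate (f ∘ suc)))
    ≡⟨ x∙yz≈y∙xz (f zero) (g (suc x)) _ ⟩
  g (suc x) + (f zero + sum (tabulate (f ∘ suc))) ∎
  where open ≡-Reasoning

without : ∀ {n} → Fin n → (Fin n → ℕ) → Fin n → ℕ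
without x f v = if does (v Fin.≟ x) then 0 else f v

without-other : ∀ {n} {x v} (f : Fin n → ℕ) → v ≢ x → without x f v ≡ f v
without-other {x = x} {v} f v≢x = if-false (dec-false (v Fin.≟ x) v≢x)

without-self : ∀ {n} x (f : Fin n → ℕ) → without x f x ≡ 0
without-self x f = if-true (dec-true (x Fin.≟ x) refl)

sum-without : ∀ {n} x (f : Fin n → ℕ) →
              sum (tabulate f) ≡ f x + sum (tabulate (without x f))
sum-without x f = sym (trans
  (sum-exchange f (without x f) x (λ v v≢x → sym (without-other f v≢x)))
  (cong (_+ _) (without-self x f)))

sum-zero : ∀ {n} (f : Fin n → ℕ) → (∀ v → f v ≡ 0) → sum (tabulate f) ≡ 0
sum-zero {zero}  f f≡0 = refl
sum-zero {suc n} f f≡0 = cong₂ _+_ (f≡0 zero) (sum-zero (f ∘ suc) (f≡0 ∘ suc))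

-- Split off the value at `e zero` and continue with the function set to 0 there; by injectivity its
-- values at the other `e i` are unchanged.
sum-reindex : ∀ {m n} (f : Fin n → ℕ) (e : Fin m → Fin n) → Injective _≡_ _≡_ e →
              (∀ v → (∀ i → e i ≢ v) → f v ≡ 0) →
              sum (tabulate f) ≡ sum (tabulate (f ∘ e))
sum-reindex {zero} f e e-inj f≡0 = sum-zero f (λ v → f≡0 v λ ())
sum-reindex {suc m} f e e-inj f≡0 = trans (sum-without (e zero) f) (cong (f (e zero) +_)
  (trans (sum-reindex (without (e zero) f) (e ∘ suc) (Fin.suc-injective ∘ e-inj) vanish)
         (cong sum (tabulate-cong {f = without (e zero) f ∘ e ∘ suc}
           λ i → without-other f λ eq → Fin.0≢1+n (e-inj (sym eq))))))
  where
  vanish : ∀ v → (∀ i → e (suc i) ≢ v) → without (e zero) f v ≡ 0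
  vanish v missed with v Fin.≟ e zero
  ... | yes _   = refl
  ... | no v≢e0 = f≡0 v λ where
    zero    e0≡v → v≢e0 (sym e0≡v)
    (suc i) e≡v  → missed i e≡v

sum-lower : ∀ {d n} (f : Fin n → ℕ) (e : Fin d → Fin n) → Injective _≡_ _≡_ e →
            (∀ i → 1 ≤ f (e i)) → d ≤ sum (tabulate f)
sum-lower {zero}  f e e-inj f≥1 = z≤n
sum-lower {suc d} f e e-inj f≥1 = ≤-trans
  (+-mono-≤ (f≥1 zero) (sum-lower (without (e zero) f) (e ∘ suc) (Fin.suc-injective ∘ e-inj)
    λ i → subst (1 ≤_) (sym (without-other f λ eq → Fin.0≢1+n (e-inj (sym eq)))) (f≥1 (suc i))))
  (≤-reflexive (sym (sum-without (e zero) f)))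

lookup-injective : ∀ {A : Set} {xs : List A} → Unique xs →
                   ∀ i j → List.lookup xs i ≡ List.lookup xs j → i ≡ j
lookup-injective (_  ∷ _) zero    zero    eq = refl
lookup-injective (x∉ ∷ _) zero    (suc j) eq = contradiction eq (ListAll.lookup x∉ (∈-lookup j))
lookup-injective (x∉ ∷ _) (suc i) zero    eq = contradiction (sym eq) (ListAll.lookup x∉ (∈-lookup i))
lookup-injective (_  ∷ u) (suc i) (suc j) eq = cong suc (lookup-injective u i j eq)

nothing? : ∀ {A : Set} (a : Maybe A) → Dec (a ≡ nothing)
nothing? nothing  = yes refl
nothing? (just _) = no λ ()

≢nothing : ∀ {A : Set} {a : Maybe A} → a ≢ nothing → ∃[ s ] a ≡ just s
≢nothing {a = nothing} a≢ = contradiction refl a≢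
≢nothing {a = just s}  a≢ = s , refl

height>0 : ∀ {k} (s : Stack k) → 0 < height s
height>0 (stack _ h) = >-nonZero⁻¹ h

module _ {n k : ℕ} (G : Graph n) (t : ℕ) where

  module _ (δ : Config n k) (x : Fin n) (s : Stack k) where

    collected : ℕ
    collected = collectedHeight G δ (colour s) x

    place-self : place G t δ x s x ≡
                 (if does (t ≤? height s + collected) then nothing else just (grow s collected))
    place-self = if-true (dec-true (x Fin.≟ x) refl)

    place-other : ∀ {v} → v ≢ x → place G t δ x s v ≡
                  (if sameColourNeighbour G δ (colour s) x v then nothing else δ v)
    place-other {v} v≢x = if-false (dec-false (v Fin.≟ x) v≢x)

    place-vanish : t ≤ height s + collected → place G t δ x s x ≡ nothing
    place-vanish le = trans place-self (if-true (dec-true (t ≤? height s + collected) le))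

    place-grow : height s + collected < t → place G t δ x s x ≡ just (grow s collected)
    place-grow lt = trans place-self (if-false (dec-false (t ≤? height s + collected) (<⇒≱ lt)))

    place-self-colour : All (λ s′ → colour s′ ≡ colour s) (place G t δ x s x)
    place-self-colour with t ≤? height s + collected
    ... | yes le = subst (All _) (sym (place-vanish le)) nothing
    ... | no ¬le = subst (All _) (sym (place-grow (≰⇒> ¬le))) (just refl)

    place-clear : ∀ {v s′} → v ≢ x → adj G x v ≡ true → δ v ≡ just s′ → colour s′ ≡ colour s →
                  place G t δ x s v ≡ nothing
    place-clear {v} v≢x a e refl rewrite place-other v≢x | a | e
      | dec-true (colour s Fin.≟ colour s) refl = refl

    place-keeps : ∀ {v} (P : Maybe (Stack k) → Set) → v ≢ x → P nothing → P (δ v) →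
                  P (place G t δ x s v)
    place-keeps {v} P v≢x p q rewrite place-other v≢x
      with sameColourNeighbour G δ (colour s) x v
    ... | true  = p
    ... | false = q

    -- Away from `x` a placement can only keep or empty a vertex, so an invariant that tolerates
    -- empty vertices is at stake only at `x`.
    place-elim : ∀ v (P : Maybe (Stack k) → Set) → (v ≡ x → P (place G t δ x s x)) →
                 (v ≢ x → P nothing × P (δ v)) → P (place G t δ x s v)
    place-elim v P at off = decide (v Fin.≟ x)
      where
      decide : Dec (v ≡ x) → P (place G t δ x s v)
      decide (yes refl) = at refl
      decide (no  v≢x)  = let p , q = off v≢x in place-keeps P v≢x p q

  -- The next stack goes on vertex number `i`. Merging only empties other vertices, so those beyond
  -- `i` stay empty.
  placeable-few : ∀ {δ} S i → (∀ v → i ≤ toℕ v → δ v ≡ nothing) → i + length S ≤ n →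
                  Placeable G t δ S
  placeable-few {δ} []      i free i≤n = done
  placeable-few {δ} (s ∷ S) i free i<n =
    next x (free x (≤-reflexive (sym (Fin.toℕ-fromℕ< _))))
      (placeable-few S (suc i)
        (λ v i<v → place-keeps δ x s (_≡ nothing)
          (λ v≡x → <⇒≢ i<v (trans (sym (Fin.toℕ-fromℕ< _)) (cong toℕ (sym v≡x))))
          refl (free v (<⇒≤ i<v)))
        (subst (_≤ n) (+-suc i (length S)) i<n))
    where
    x : Fin n
    x = fromℕ< (≤-trans (m<m+n i z<s) i<n)

  adj⇒≢ : ∀ {u v} → adj G u v ≡ true → u ≢ v
  adj⇒≢ {u} a refl with trans (sym a) (no-loop G u)
  ... | ()

  module Star {d} (t≤1+d : t ≤ suc d) (x : Fin n) (leaf : Fin (k * d) → Fin n)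
              (leaf-injective : Injective _≡_ _≡_ leaf) (x-leaf : ∀ i → adj G x (leaf i) ≡ true)
              where

    leafColour : Fin (k * d) → Fin k
    leafColour i = proj₁ (remQuot d i)

    Inv : Config n k → Set
    Inv δ = δ x ≡ nothing × (∀ i → All (λ s → colour s ≡ leafColour i) (δ (leaf i)))

    leaf≢x : ∀ i → leaf i ≢ x
    leaf≢x i eq = adj⇒≢ (x-leaf i) (sym eq)

    full : ∀ {δ} c → Inv δ → (∀ j → δ (leaf (combine c j)) ≢ nothing) → d ≤ collectedHeight G δ c x
    full {δ} c (_ , col) occupied = sum-lower _ (λ j → leaf (combine c j))
      (λ eq → proj₂ (Fin.combine-injective c _ c _ (leaf-injective eq))) positive
      where
      positive : ∀ j → 1 ≤ (if sameColourNeighbour G δ c x (leaf (combine c j))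
                            then heightAt δ (leaf (combine c j)) else 0)
      positive j rewrite x-leaf (combine c j)
        with δ (leaf (combine c j)) | col (combine c j) | occupied j
      ... | nothing | _       | occ = contradiction refl occ
      ... | just s′@(stack _ (suc _)) | just e | _
        rewrite e | cong proj₁ (Fin.remQuot-combine c j) | dec-true (c Fin.≟ c) refl = s≤s z≤n

    placeable : ∀ S {δ} → Inv δ → Placeable G t δ S
    placeable []      inv = done
    placeable (s ∷ S) {δ} inv@(empty , col)
      with Fin.any? (λ j → nothing? (δ (leaf (combine (colour s) j))))
    ... | yes (j , e) = next y e (placeable S
            ( place-keeps δ y s (_≡ nothing) (leaf≢x _ ∘ sym) refl empty
            , λ i → colours i))
      where
      y = leaf (combine (colour s) j)
      colours : ∀ i → All (λ s → colour s ≡ leafColour i) (place G t δ y s (leaf i))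
      colours i = place-elim δ y s (leaf i) (All _)
        (λ i≡y → subst (λ c → All (λ s → colour s ≡ c) _)
          (sym (trans (cong leafColour (leaf-injective i≡y)) (cong proj₁ (Fin.remQuot-combine (colour s) j))))
          (place-self-colour δ y s))
        (λ _ → nothing , col i)
    -- Each of the `d` leaves of this colour contributes at least 1, and so does the stack itself;
    -- this is why `t ≤ suc d` is enough.
    ... | no none = next x empty (placeable S
            ( place-vanish δ x s (≤-trans t≤1+d (+-mono-≤ (height>0 s)
                (full (colour s) inv (λ j e → none (j , e)))))
            , λ i → place-keeps δ x s (All _) (leaf≢x i) nothing (col i)))

  record Matching (j : ℕ) : Set where
    field
      end           : Fin j → Bool → Fin n
      end-injective : ∀ {c d a b} → end c a ≡ end d b → c ≡ d × a ≡ b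
      matched       : ∀ c a → adj G (end c a) (end c (not a)) ≡ true

  module _ (M : Matching k) where
    open Matching M

    private
      Inv : Config n k → Set
      Inv δ = (∀ c a → All (λ s → colour s ≡ c) (δ (end c a))) × (∀ c → ∃[ a ] δ (end c a) ≡ nothing)

    -- The invariant keeps one end of every edge empty. A stack put there absorbs what its colour
    -- has left on the other end, which is then empty, whether or not the merged stack vanishes.
    placeable-matching : ∀ S {δ} → Inv δ → Placeable G t δ S
    placeable-matching []      inv = done
    placeable-matching (s ∷ S) {δ} (col , free) with free (colour s)
    ... | a , e = next x e (placeable-matching S (colours , free′))
      where
      c = colour s
      x = end c a

      colours : ∀ c′ a′ → All (λ s → colour s ≡ c′) (place G t δ x s (end c′ a′))
      colours c′ a′ = place-elim δ x s (end c′ a′) (All _)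
        (λ ≡x → subst (λ c → All (λ s → colour s ≡ c) _) (sym (proj₁ (end-injective ≡x)))
          (place-self-colour δ x s))
        (λ _ → nothing , col c′ a′)

      free′ : ∀ c′ → ∃[ a′ ] place G t δ x s (end c′ a′) ≡ nothing
      free′ c′ with c′ Fin.≟ c
      ... | no c′≢c = let a′ , e′ = free c′ in
        a′ , place-keeps δ x s (_≡ nothing) (c′≢c ∘ proj₁ ∘ end-injective) refl e′
      ... | yes refl = not a , cleared
        where
        y≢x : end c (not a) ≢ x
        y≢x = adj⇒≢ (matched c a) ∘ sym
        cleared : place G t δ x s (end c (not a)) ≡ nothing
        cleared with nothing? (δ (end c (not a)))
        ... | yes e = place-keeps δ x s (_≡ nothing) y≢x refl e
        ... | no ¬e with s′ , e ← ≢nothing ¬e =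
          place-clear δ x s y≢x (matched c a) e (drop-just (subst (All _) e (col c (not a))))

  neighbours : Fin n → List (Fin n)
  neighbours v = filter (λ u → adj G v u Bool.≟ true) (allFin n)

  neighbours-unique : ∀ v → Unique (neighbours v)
  neighbours-unique v = Unique.filter⁺ _ (Unique.allFin⁺ n)

  closed : Fin n → List (Fin n)
  closed v = v ∷ neighbours v

  cover : ∀ {j} → (Fin j → Bool → Fin n) → List (Fin n)
  cover {zero}  end = []
  cover {suc j} end = closed (end zero false) ++ closed (end zero true) ++ cover (end ∘ suc)

  ∈-cover : ∀ {j} (end : Fin j → Bool → Fin n) c a {u} → u ∈ closed (end c a) → u ∈ cover end
  ∈-cover end zero    false u∈ = ∈-++⁺ˡ u∈
  ∈-cover end zero    true  u∈ = ∈-++⁺ʳ (closed (end zero false)) (∈-++⁺ˡ u∈)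
  ∈-cover end (suc c) a     u∈ =
    ∈-++⁺ʳ (closed (end zero false)) (∈-++⁺ʳ (closed (end zero true)) (∈-cover (end ∘ suc) c a u∈))

  -- The strict bound on the number of neighbours leaves room for the vertex itself: a closed
  -- neighbourhood has at most `D` members.
  length-cover : ∀ {D} → (∀ v → length (neighbours v) < D) → ∀ {j} (end : Fin j → Bool → Fin n) →
                 length (cover end) ≤ j * (2 * D)
  length-cover few {zero}  end = z≤n
  length-cover {D} few {suc j} end = begin
    length (cover end)
      ≡⟨ length-++ (closed (end zero false)) ⟩
    length (closed (end zero false)) + length (closed (end zero true) ++ cover (end ∘ suc))
      ≡⟨ cong (length (closed (end zero false)) +_) (length-++ (closed (end zero true))) ⟩
    length (closed (end zero false)) + (length (closed (end zero true)) + length (cover (end ∘ suc)))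
      ≤⟨ +-mono-≤ (few _) (+-mono-≤ (few _) (length-cover few (end ∘ suc))) ⟩
    D + (D + j * (2 * D))
      ≡⟨ +-assoc D D _ ⟨
    (D + D) + j * (2 * D)
      ≡⟨ cong (λ a → (D + a) + j * (2 * D)) (+-identityʳ D) ⟨
    2 * D + j * (2 * D) ∎
    where open ≤-Reasoning

  covered⇒≤ : ∀ {m} (e : Fin m → Fin n) → Injective _≡_ _≡_ e → ∀ xs → (∀ i → e i ∈ xs) → m ≤ length xs
  covered⇒≤ {m} e e-inj xs e∈ with m ≤? length xs
  ... | yes m≤ = m≤
  ... | no m≰ with i , j , i<j , eq ← Fin.pigeonhole (≰⇒> m≰) (λ i → index (e∈ i)) =
    contradiction (e-inj (trans (lookup-index (e∈ i)) (trans (cong (List.lookup xs) eq) (sym (lookup-index (e∈ j))))))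
      (Fin.<⇒≢ i<j)

  module _ {m} (e : Fin m → Fin n) (e-injective : Injective _≡_ _≡_ e)
           (e-adj : ∀ i → ∃[ w ] adj G (e i) w ≡ true)
           {D} (few : ∀ v → length (neighbours v) < D) where

    -- Greedy extension. The closed neighbourhoods of the ends so far contain fewer than `m`
    -- vertices, so some `e i` lies outside all of them. Then no neighbour of `e i` is an end
    -- either, and any edge at `e i` can be added. With `2 * D` on the right, the hypothesis for
    -- `suc j` says exactly that `j * (2 * D) < m`.
    matching : ∀ j → j * (2 * D) < m + 2 * D → Matching j
    matching zero    _ = record { end = λ () ; end-injective = λ { {()} } ; matched = λ () }
    matching (suc j) lt = extend (Fin.any? λ i → ¬? (e i ∈? cover end))
      where
      open DecMembership Fin._≟_ using (_∈?_)
      lt′ : j * (2 * D) < m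
      lt′ = +-cancelʳ-< (2 * D) _ _ (subst (_< m + 2 * D) (+-comm (2 * D) _) lt)
      M = matching j (≤-trans lt′ (m≤m+n m _))
      open Matching M
      extend : Dec (∃[ i ] e i ∉ cover end) → Matching (suc j)
      extend (no all∈) = contradiction (covered⇒≤ e e-injective (cover end) e∈)
        (<⇒≱ (≤-<-trans (length-cover few end) lt′))
        where
        e∈ : ∀ i → e i ∈ cover end
        e∈ i with e i ∈? cover end
        ... | yes i∈ = i∈
        ... | no  i∉ = contradiction (i , i∉) all∈
      extend (yes (i , u∉)) = record { end = end′ ; end-injective = inj ; matched = matched′ }
        where
        u = e i
        w = proj₁ (e-adj i)

        u≢ : ∀ c a → u ≢ end c a
        u≢ c a eq = u∉ (∈-cover end c a (here eq))

        w≢ : ∀ c a → w ≢ end c a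
        w≢ c a eq = u∉ (∈-cover end c a (there (∈-filter⁺ (λ v → adj G (end c a) v Bool.≟ true) (∈-allFin u)
          (trans (adj-sym G _ u) (trans (cong (adj G u) (sym eq)) (proj₂ (e-adj i)))))))

        end′ : Fin (suc j) → Bool → Fin n
        end′ zero    false = u
        end′ zero    true  = w
        end′ (suc c) a     = end c a

        u≢w : u ≢ w
        u≢w = adj⇒≢ (proj₂ (e-adj i))

        inj : ∀ {c d a b} → end′ c a ≡ end′ d b → c ≡ d × a ≡ b
        inj {zero}  {zero}  {false} {false} eq = refl , refl
        inj {zero}  {zero}  {false} {true}  eq = contradiction eq u≢w
        inj {zero}  {zero}  {true}  {false} eq = contradiction (sym eq) u≢w
        inj {zero}  {zero}  {true}  {true}  eq = refl , refl
        inj {zero}  {suc d} {false}         eq = contradiction eq (u≢ d _)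
        inj {zero}  {suc d} {true}          eq = contradiction eq (w≢ d _)
        inj {suc c} {zero}  {_}     {false} eq = contradiction (sym eq) (u≢ c _)
        inj {suc c} {zero}  {_}     {true}  eq = contradiction (sym eq) (w≢ c _)
        inj {suc c} {suc d}                 eq = map₁ (cong suc) (end-injective eq)

        matched′ : ∀ c a → adj G (end′ c a) (end′ c (not a)) ≡ true
        matched′ zero    false = proj₂ (e-adj i)
        matched′ zero    true  = trans (adj-sym G w u) (proj₂ (e-adj i))
        matched′ (suc c) a     = matched c a

  -- The number `k * t` plays both parts: a vertex with that many neighbours is the centre of a star
  -- with `t` leaves per colour, and otherwise it bounds all degrees in the construction of a
  -- matching.
  placeable-many : ∀ {m} (e : Fin m → Fin n) → Injective _≡_ _≡_ e →
                   (∀ i → ∃[ w ] adj G (e i) w ≡ true) →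
                   k * (2 * (k * t)) < m → ∀ S → Placeable G t emptyConfig S
  placeable-many e e-inj e-adj lt S with Fin.any? (λ v → k * t ≤? length (neighbours v))
  ... | yes (v , many) = Star.placeable (n≤1+n t) v (λ i → List.lookup (neighbours v) (inject≤ i many))
          (λ eq → Fin.inject≤-injective many many _ _ (lookup-injective (neighbours-unique v) _ _ eq))
          (λ i → proj₂ (∈-filter⁻ (λ u → adj G v u Bool.≟ true) {xs = allFin n} (∈-lookup (inject≤ i many))))
          S (refl , λ _ → nothing)
  ... | no none = placeable-matching
          (matching e e-inj e-adj (λ v → ≰⇒> (λ le → none (v , le))) k (≤-trans lt (m≤m+n _ _)))
          S ((λ _ _ → nothing) , λ _ → false , refl)

-- Dynamic programming over the configurations of the kernel

-- This and the following arithmetic is written with `fold`, in the shape of the terms compiled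
-- later, so that the value of such a term is the corresponding function by computation.
ifnz : ℕ → ℕ → ℕ → ℕ
ifnz c a b = fold c b λ _ _ → a

ifnz-pos : ∀ {c} a b → 0 < c → ifnz c a b ≡ a
ifnz-pos {suc _} a b _ = refl

ifnz-zero : ∀ {c} a b → c ≡ 0 → ifnz c a b ≡ b
ifnz-zero a b refl = refl

ifnz-const : ∀ c a → ifnz c a a ≡ a
ifnz-const zero    a = refl
ifnz-const (suc _) a = refl

distinct⇒distance>0 : ∀ {m n} → m ≢ n → 0 < (m ∸ n) + (n ∸ m)
distinct⇒distance>0 {m} {n} m≢n = n≢0⇒n>0 λ z →
  m≢n (≤-antisym (m∸n≡0⇒m≤n (m+n≡0⇒m≡0 _ z)) (m∸n≡0⇒m≤n (m+n≡0⇒n≡0 (m ∸ n) z)))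

mul : ℕ → ℕ → ℕ
mul a b = fold a 0 λ _ c → b + c

mul≡* : ∀ a b → mul a b ≡ a * b
mul≡* zero    b = refl
mul≡* (suc a) b = cong (b +_) (mul≡* a b)

pow : ℕ → ℕ → ℕ
pow b m = fold m 1 λ _ a → mul b a

mod : ℕ → ℕ → ℕ
mod n d = fold n 0 λ _ r → ifnz (d ∸ suc r) (suc r) 0

div : ℕ → ℕ → ℕ
div n d = fold n 0 λ i q → ifnz (d ∸ suc (mod i d)) q (suc q)

mod-+ : ∀ q {r d} → r < d → mod (r + q * d) d ≡ r
mod-+ zero    {zero} _ = refl
-- One below a positive multiple of `suc d` the remainder is `d`, and the count wraps around.
mod-+ (suc q) {zero} {suc d} _ rewrite mod-+ q {d} {suc d} ≤-refl | n∸n≡0 d = refl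
mod-+ q {suc r} {d} 1+r<d rewrite mod-+ q {r} {d} (<⇒≤ 1+r<d) =
  ifnz-pos (suc r) 0 (m<n⇒0<n∸m 1+r<d)

div-+ : ∀ q {r d} → r < d → div (r + q * d) d ≡ q
div-+ zero    {zero} _ = refl
div-+ (suc q) {zero} {suc d} _ rewrite mod-+ q {d} {suc d} ≤-refl | n∸n≡0 d =
  cong suc (div-+ q {d} ≤-refl)
div-+ q {suc r} {d} 1+r<d rewrite mod-+ q {r} {d} (<⇒≤ 1+r<d) =
  trans (ifnz-pos (div (r + q * d) d) _ (m<n⇒0<n∸m 1+r<d)) (div-+ q (<⇒≤ 1+r<d))

mod< : ∀ n d → mod n (suc d) < suc d
mod< zero    d = s≤s z≤n
mod< (suc n) d with d ∸ mod n (suc d) in eq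
... | zero  = s≤s z≤n
... | suc _ = s≤s (m∸n≢0⇒n<m λ z → 1+n≢0 (trans (sym eq) z))

-- Horner's rule: `f 0` is the leading digit. Hence `digit` removes `m ∸ suc v` digits to bring
-- position `v` to the end.
encode : ℕ → ℕ → (ℕ → ℕ) → ℕ
encode b m f = fold m 0 λ i a → f i + mul a b

digit : ℕ → ℕ → ℕ → ℕ → ℕ
digit b m σ v = mod (fold (m ∸ suc v) σ λ _ a → div a b) b

module _ {b : ℕ} {f : ℕ → ℕ} where

  div-encode : ∀ {m} → f m < b → div (encode b (suc m) f) b ≡ encode b m f
  div-encode {m} fm<b rewrite mul≡* (encode b m f) b = div-+ (encode b m f) fm<b

  mod-encode : ∀ {m} → f m < b → mod (encode b (suc m) f) b ≡ f m
  mod-encode {m} fm<b rewrite mul≡* (encode b m f) b = mod-+ (encode b m f) fm<b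

  digit-encode : ∀ {m v} → (∀ {i} → i < m → f i < b) → v < m → digit b m (encode b m f) v ≡ f v
  digit-encode {m} {v} f<b v<m = begin
    mod (shift (m ∸ suc v)) b
      ≡⟨ cong (λ a → mod a b) (shift≡ (m ∸ suc v) (suc v) (m∸n+n≡m v<m)) ⟩
    mod (encode b (suc v) f) b
      ≡⟨ mod-encode (f<b v<m) ⟩
    f v ∎
    where
    open ≡-Reasoning
    shift : ℕ → ℕ
    shift j = fold j (encode b m f) λ _ a → div a b
    shift≡ : ∀ j i → j + i ≡ m → shift j ≡ encode b i f
    shift≡ zero    i refl = refl
    shift≡ (suc j) i refl =
      trans (cong (λ a → div a b) (shift≡ j (suc i) (+-suc j i))) (div-encode (f<b (s≤s (m≤n+m i j))))

  encode<pow : ∀ m → (∀ {i} → i < m → f i < b) → encode b m f < pow b m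
  encode<pow zero    f<b = ≤-refl
  encode<pow (suc m) f<b = begin-strict
    f m + mul (encode b m f) b ≡⟨ cong (f m +_) (mul≡* (encode b m f) b) ⟩
    f m + encode b m f * b     <⟨ +-monoˡ-< _ (f<b ≤-refl) ⟩
    suc (encode b m f) * b     ≤⟨ *-monoˡ-≤ b (encode<pow m (f<b ∘ m<n⇒m<1+n)) ⟩
    pow b m * b                ≡⟨ *-comm (pow b m) b ⟩
    b * pow b m                ≡⟨ mul≡* b (pow b m) ⟨
    mul b (pow b m) ∎
    where open ≤-Reasoning

fold-sum : ∀ {m} (g : ℕ → ℕ) (f : Fin m → ℕ) → (∀ i → g (toℕ i) ≡ f i) →
           fold m 0 (λ i a → g i + a) ≡ sum (tabulate f)
fold-sum {zero}  g f g≡f = refl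
fold-sum {suc m} g f g≡f =
  trans (shift m) (cong₂ _+_ (g≡f zero) (fold-sum (g ∘ suc) (f ∘ suc) (g≡f ∘ suc)))
  where
  shift : ∀ m → fold (suc m) 0 (λ i a → g i + a) ≡ g 0 + fold m 0 (λ i a → g (suc i) + a)
  shift zero    = refl
  shift (suc m) = trans (cong (g (suc m) +_) (shift m)) (x∙yz≈y∙xz (g (suc m)) (g 0) _)

-- m ∸ (m ∸ n) is the minimum of m and n, in operations of the machine.
m∸[m∸n]≤n : ∀ m n → m ∸ (m ∸ n) ≤ n
m∸[m∸n]≤n m n = m≤n+o⇒m∸n≤o m (m ∸ n) (≤-trans (m≤n+m∸n m n) (≤-reflexive (+-comm n _)))

min≤⇒ : ∀ m n {k} → m ∸ (m ∸ n) ≤ k → m ≤ k ⊎ n ≤ k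
min≤⇒ m n {k} le with ≤-total n m
... | inj₁ n≤m = inj₂ (subst (_≤ k) (m∸[m∸n]≡n n≤m) le)
... | inj₂ m≤n = inj₁ (subst (λ a → m ∸ a ≤ k) (m≤n⇒m∸n≡0 m≤n) le)

module _ (d : ℕ) (g y : ℕ → ℕ) where

  foldMin : ℕ → ℕ
  foldMin m = fold m d λ x best → ifnz (g x) best (best ∸ (best ∸ y x))

  foldMin≤⇒ : ∀ m {k} → foldMin m ≤ k → d ≤ k ⊎ ∃[ x ] x < m × g x ≡ 0 × y x ≤ k
  foldMin≤⇒ zero    le = inj₁ le
  foldMin≤⇒ (suc m) le with g m in eq
  ... | suc _ with foldMin≤⇒ m le
  ...   | inj₁ d≤k               = inj₁ d≤k
  ...   | inj₂ (x , x<m , gx , yx) = inj₂ (x , m<n⇒m<1+n x<m , gx , yx)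
  foldMin≤⇒ (suc m) le | zero with min≤⇒ (foldMin m) (y m) le
  ...   | inj₂ ym≤k = inj₂ (m , ≤-refl , eq , ym≤k)
  ...   | inj₁ le′ with foldMin≤⇒ m le′
  ...     | inj₁ d≤k               = inj₁ d≤k
  ...     | inj₂ (x , x<m , gx , yx) = inj₂ (x , m<n⇒m<1+n x<m , gx , yx)

  foldMin-suc≤ : ∀ m → foldMin (suc m) ≤ foldMin m
  foldMin-suc≤ m with g m
  ... | suc _ = ≤-refl
  ... | zero  = m∸n≤m (foldMin m) (foldMin m ∸ y m)

  foldMin≤d : ∀ m → foldMin m ≤ d
  foldMin≤d zero    = ≤-refl
  foldMin≤d (suc m) = ≤-trans (foldMin-suc≤ m) (foldMin≤d m)

  foldMin≤y : ∀ {m x} → x < m → g x ≡ 0 → foldMin m ≤ y x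
  foldMin≤y {suc m} {x} x<1+m gx with m≤n⇒m<n∨m≡n (≤-pred x<1+m)
  ... | inj₁ x<m  = ≤-trans (foldMin-suc≤ m) (foldMin≤y x<m gx)
  ... | inj₂ refl rewrite gx = m∸[m∸n]≤n (foldMin m) (y m)

-- Codes of kernel configurations and the recursion on them

module Codes (O : ℕ → ℕ → ℕ) (m t b : ℕ) where

  -- The edge bit minus the distance of the colours: positive only for a neighbour with the right
  -- colour. An empty vertex passes for colour 0, which is harmless, since its height reads as 0 and
  -- clearing leaves its digit 0.
  same : ℕ → ℕ → ℕ → ℕ → ℕ
  same σ x c u = (1 ∸ (1 ∸ O x u)) ∸ ((q ∸ c) + (c ∸ q))
    where q = div (digit b m σ u) t

  collect : ℕ → ℕ → ℕ → ℕ
  collect σ x c = fold m 0 λ u a → ifnz (same σ x c u) (mod (digit b m σ u) t) 0 + a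

  newDigit : ℕ → ℕ → ℕ → ℕ → ℕ → ℕ
  newDigit σ x c h v =
    ifnz ((v ∸ x) + (x ∸ v))
      (ifnz (same σ x c v) 0 (digit b m σ v))
      (ifnz (t ∸ (h + collect σ x c)) ((h + collect σ x c) + mul c t) 0)

  -- This has to hold for every `σ`: the table also has entries for codes that represent no
  -- configuration, and moves from these must stay inside it.
  newDigit< : ∀ {k} → b ≡ suc (k * t) → ∀ {c} → c < k → ∀ σ x h v → newDigit σ x c h v < b
  newDigit< {k} refl {c} c<k σ x h v with (v ∸ x) + (x ∸ v)
  ... | suc _ with same σ x c v
  ...   | zero  = mod< (fold (m ∸ suc v) σ λ _ a → div a (suc (k * t))) (k * t)
  ...   | suc _ = s≤s z≤n
  newDigit< {k} refl {c} c<k σ x h v | zero with t ∸ (h + collect σ x c) in eq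
  ...   | zero  = s≤s z≤n
  ...   | suc _ = s≤s (≤-trans
    (+-mono-≤ (<⇒≤ (m∸n≢0⇒n<m λ z → 1+n≢0 (trans (sym eq) z))) (≤-reflexive (mul≡* c t)))
    (*-monoˡ-≤ t c<k))

  move : ℕ → ℕ → ℕ → ℕ → ℕ
  move σ x c h = encode b m (newDigit σ x c h)

  -- The number of empty isolated vertices needed to place a sequence of stacks
  -- from the kernel configuration σ.  The initial value of the minimum is for
  -- putting s on an isolated vertex: this uses up the vertex if height s < t,
  -- while otherwise s vanishes and one empty vertex suffices for the moment.
  value : ∀ {k} → List (Stack k) → ℕ → ℕ
  value []      σ = 0
  value (s ∷ S) σ =
    foldMin (1 + (value S σ ∸ (1 ∸ (t ∸ height s)))) (digit b m σ)
            (λ x → value S (move σ x (toℕ (colour s)) (height s))) m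

-- Correctness of the recursion

record Kernel {n : ℕ} (G : Graph n) (m : ℕ) : Set where
  field
    isolated        : Fin n → Bool
    isolated-adj    : ∀ {v} → isolated v ≡ true → ∀ u → adj G v u ≡ false
    ker             : Fin m → Fin n
    ker-injective   : Injective _≡_ _≡_ ker
    ker-isolated    : ∀ a → isolated (ker a) ≡ false
    ker-complete    : ∀ {v} → isolated v ≡ false → ∃[ a ] ker a ≡ v

isNothing : ∀ {A : Set} → Maybe A → Bool
isNothing (just _) = false
isNothing nothing  = true

-- Heights strictly between 0 and `t` make this non-zero and let division by `t` recover colour and
-- height. Placement preserves this range, because taller stacks vanish.
code : ∀ {k} → ℕ → Maybe (Stack k) → ℕ
code t nothing  = 0
code t (just s) = height s + toℕ (colour s) * t

Short : ∀ {k} → ℕ → Maybe (Stack k) → Set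
Short t = All λ s → height s < t

module _ {k t : ℕ} where

  code≡0⇒ : ∀ {a : Maybe (Stack k)} → code t a ≡ 0 → a ≡ nothing
  code≡0⇒ {nothing} _ = refl
  code≡0⇒ {just s}  e = contradiction (m+n≡0⇒m≡0 (height s) e) (>⇒≢ (height>0 s))

  -- What `same` becomes once the edge bit and the digit are known.
  match : Fin k → Bool → ℕ → ℕ
  match c x d = (1 ∸ (1 ∸ (if x then 1 else 0))) ∸ ((div d t ∸ toℕ c) + (toℕ c ∸ div d t))

  match-just : ∀ c x s → height s < t →
               match c x (code t (just s)) ≡ (if x ∧ hasColour {0} c (just s) then 1 else 0)
  match-just c x s h<t rewrite div-+ (toℕ (colour s)) h<t with x | colour s Fin.≟ c
  ... | false | _ = 0∸n≡0 ((toℕ (colour s) ∸ toℕ c) + (toℕ c ∸ toℕ (colour s)))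
  ... | true  | yes refl rewrite n∸n≡0 (toℕ c) = refl
  ... | true  | no c≢ = m≤n⇒m∸n≡0 (distinct⇒distance>0 (c≢ ∘ Fin.toℕ-injective))

  weight-code : ∀ c x {a} → Short t a →
    ifnz (match c x (code t a)) (mod (code t a) t) 0 ≡
    (if x ∧ hasColour {0} c a then maybe′ height 0 a else 0)
  weight-code c x nothing = trans (ifnz-const (match c x 0) 0) (sym (if-false (∧-zeroʳ x)))
  weight-code c x {just s} (just h<t)
    rewrite match-just c x s h<t | mod-+ (toℕ (colour s)) h<t with x ∧ hasColour {0} c (just s)
  ... | true  = refl
  ... | false = refl

  clear-code : ∀ c x {a} → Short t a →
    ifnz (match c x (code t a)) 0 (code t a) ≡ code t (if x ∧ hasColour {0} c a then nothing else a)
  clear-code c x nothing = trans (ifnz-const (match c x 0) 0) (sym (cong (code t) (if-false (∧-zeroʳ x))))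
  clear-code c x {just s} (just h<t) rewrite match-just c x s h<t with x ∧ hasColour {0} c (just s)
  ... | true  = refl
  ... | false = refl

module _ {n m k : ℕ} (G : Graph n) (t : ℕ) (K : Kernel G m) (O : ℕ → ℕ → ℕ)
         (O-adj : ∀ a u → O (toℕ a) (toℕ u) ≡
                          (if adj G (Kernel.ker K a) (Kernel.ker K u) then 1 else 0)) where

  open Kernel K

  private
    b : ℕ
    b = suc (k * t)

  open Codes O m t b

  -- Stacks on isolated vertices leave no trace in `σ`, as they never interact; `freeCount` accounts
  -- for those vertices.
  record Represents (δ : Config n k) (σ : ℕ) : Set where
    field
      short    : ∀ v → Short t (δ v)
      digit-at : ∀ a → digit b m σ (toℕ a) ≡ code t (δ (ker a))

  open Represents

  freeCount : Config n k → ℕ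
  freeCount δ = sum (tabulate λ v → if isolated v ∧ isNothing (δ v) then 1 else 0)

  place-short : ∀ {δ : Config n k} x s → (∀ v → Short t (δ v)) → ∀ v → Short t (place G t δ x s v)
  place-short {δ} x s short v = place-elim G t δ x s v (Short t)
    (λ _ → self (t ≤? height s + collected G t δ x s)) (λ _ → nothing , short v)
    where
    self : Dec (t ≤ height s + collected G t δ x s) → Short t (place G t δ x s x)
    self (yes le) = subst (Short t) (sym (place-vanish G t δ x s le)) nothing
    self (no ¬le) = subst (Short t) (sym (place-grow G t δ x s (≰⇒> ¬le))) (just (≰⇒> ¬le))

  module _ {δ σ} (R : Represents δ σ) (a : Fin m) (s : Stack k) where

    private
      c h : ℕ
      c = toℕ (colour s)
      h = height s

    -- A vertex outside the kernel is isolated and contributes nothing, so the sum over all vertices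
    -- reduces to the kernel.
    collect-correct : collect σ (toℕ a) c ≡ collected G t δ (ker a) s
    collect-correct = trans (fold-sum {m} _ _ weight)
      (sym (sum-reindex _ ker ker-injective vanish))
      where
      weight : ∀ u → ifnz (same σ (toℕ a) c (toℕ u)) (mod (digit b m σ (toℕ u)) t) 0 ≡
        (if sameColourNeighbour G δ (colour s) (ker a) (ker u) then heightAt δ (ker u) else 0)
      weight u rewrite digit-at R u | O-adj a u = weight-code (colour s) (adj G (ker a) (ker u)) (short R (ker u))
      vanish : ∀ v → (∀ u → ker u ≢ v) →
        (if sameColourNeighbour G δ (colour s) (ker a) v then heightAt δ v else 0) ≡ 0
      vanish v missed with isolated v in eq
      ... | false = let u , e = ker-complete eq in contradiction e (missed u)
      ... | true rewrite adj-sym G (ker a) v | isolated-adj eq (ker a) = refl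

    newDigit-correct : ∀ v → newDigit σ (toℕ a) c h (toℕ v) ≡ code t (place G t δ (ker a) s (ker v))
    newDigit-correct v with v Fin.≟ a
    ... | yes refl rewrite n∸n≡0 (toℕ v) | collect-correct = at (t ≤? h + collected G t δ (ker a) s)
      where
      at : Dec (t ≤ h + collected G t δ (ker a) s) →
        ifnz (t ∸ (h + collected G t δ (ker a) s)) ((h + collected G t δ (ker a) s) + mul c t) 0 ≡
        code t (place G t δ (ker a) s (ker a))
      at (yes le) = trans (ifnz-zero _ 0 (m≤n⇒m∸n≡0 le)) (sym (cong (code t) (place-vanish G t δ (ker a) s le)))
      at (no ¬le) = trans (ifnz-pos _ 0 (m<n⇒0<n∸m (≰⇒> ¬le)))
        (trans (cong (h + collected G t δ (ker a) s +_) (mul≡* c t)) (sym (cong (code t) (place-grow G t δ (ker a) s (≰⇒> ¬le)))))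
    ... | no v≢a = trans (ifnz-pos _ _ (distinct⇒distance>0 (v≢a ∘ Fin.toℕ-injective)))
        (trans off (sym (cong (code t) (place-other G t δ (ker a) s (v≢a ∘ ker-injective)))))
      where
      off : ifnz (same σ (toℕ a) c (toℕ v)) 0 (digit b m σ (toℕ v)) ≡
            code t (if sameColourNeighbour G δ (colour s) (ker a) (ker v) then nothing else δ (ker v))
      off rewrite digit-at R v | O-adj a v = clear-code (colour s) (adj G (ker a) (ker v)) (short R (ker v))

    move-represents : Represents (place G t δ (ker a) s) (move σ (toℕ a) c h)
    move-represents = record
      { short    = place-short (ker a) s (short R)
      ; digit-at = λ v → trans (digit-encode (λ {i} _ → newDigit< {k} refl (Fin.toℕ<n (colour s)) σ (toℕ a) h i) (Fin.toℕ<n v)) (newDigit-correct v)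
      }

    freeCount-kernel : freeCount (place G t δ (ker a) s) ≡ freeCount δ
    freeCount-kernel = cong sum (tabulate-cong unchanged)
      where
      unchanged : ∀ v → (if isolated v ∧ isNothing (place G t δ (ker a) s v) then 1 else 0) ≡
                        (if isolated v ∧ isNothing (δ v) then 1 else 0)
      unchanged v with isolated v in eq
      ... | false = refl
      ... | true  = cong (λ a → if isNothing a then 1 else 0) (trans
        (place-other G t δ (ker a) s λ v≡a → contradiction (trans (sym eq) (trans (cong isolated v≡a) (ker-isolated a))) λ ())
        (if-false (cong (_∧ hasColour {n} (colour s) (δ v)) (trans (adj-sym G (ker a) v) (isolated-adj eq (ker a))))))

  freeCount-positive : ∀ {δ v} → isolated v ≡ true → δ v ≡ nothing → 0 < freeCount δ
  freeCount-positive {δ} {v} iso e = sum-lower {1} _ (λ _ → v) (λ { {zero} {zero} _ → refl })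
    λ _ → ≤-reflexive (sym (if-true (cong₂ _∧_ iso (cong isNothing e))))

  find-free : ∀ δ → 0 < freeCount δ → ∃[ v ] isolated v ≡ true × δ v ≡ nothing
  find-free δ = go isolated δ
    where
    go : ∀ {n} (p : Fin n → Bool) (δ : Fin n → Maybe (Stack k)) →
         0 < sum (tabulate λ v → if p v ∧ isNothing (δ v) then 1 else 0) →
         ∃[ v ] p v ≡ true × δ v ≡ nothing
    go {suc n} p δ lt with p zero in ep | δ zero in eδ
    ... | true  | nothing = zero , ep , eδ
    ... | true  | just _  = let v , free = go (p ∘ suc) (δ ∘ suc) lt in suc v , free
    ... | false | _       = let v , free = go (p ∘ suc) (δ ∘ suc) lt in suc v , free

  module _ {δ : Config n k} {v} (iso : isolated v ≡ true) (e : δ v ≡ nothing) (s : Stack k) where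

    private
      δ′ : Config n k
      δ′ = place G t δ v s

      h : ℕ
      h = height s

      collected≡0 : collected G t δ v s ≡ 0
      collected≡0 = sum-reindex {0} _ (λ ()) (λ { {()} })
        (λ u _ → if-false (cong (_∧ hasColour {n} (colour s) (δ u)) (isolated-adj iso u)))

      others : ∀ u → u ≢ v → δ′ u ≡ δ u
      others u u≢v = trans (place-other G t δ v s u≢v)
        (if-false (cong (_∧ hasColour {n} (colour s) (δ u)) (isolated-adj iso u)))

      free : Config n k → Fin n → ℕ
      free δ u = if isolated u ∧ isNothing (δ u) then 1 else 0

      free-v : free δ v ≡ 1
      free-v = if-true (cong₂ _∧_ iso (cong isNothing e))

      h+collected : h + collected G t δ v s ≡ h
      h+collected = trans (cong (h +_) collected≡0) (+-identityʳ h)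

      exchange : free δ v + freeCount δ′ ≡ free δ′ v + freeCount δ
      exchange = sum-exchange (free δ) (free δ′) v
        λ u u≢v → cong (λ a → if isolated u ∧ isNothing a then 1 else 0) (sym (others u u≢v))

      freeCount-vanish : t ≤ h → freeCount δ′ ≡ freeCount δ
      freeCount-vanish t≤h = suc-injective (trans (cong (_+ freeCount δ′) (sym free-v)) (trans exchange
        (cong (_+ freeCount δ) (if-true (cong₂ _∧_ iso (cong isNothing
          (place-vanish G t δ v s (subst (t ≤_) (sym h+collected) t≤h))))))))

      freeCount-grow : h < t → suc (freeCount δ′) ≡ freeCount δ
      freeCount-grow h<t = trans (cong (_+ freeCount δ′) (sym free-v)) (trans exchange
        (cong (_+ freeCount δ) (if-false (cong₂ _∧_ iso (cong isNothing
          (place-grow G t δ v s (subst (_< t) (sym h+collected) h<t)))))))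

    isolated-represents : ∀ {σ} → Represents δ σ → Represents δ′ σ
    isolated-represents R = record
      { short    = place-short v s (short R)
      ; digit-at = λ a → trans (digit-at R a) (cong (code t) (sym (others (ker a) λ ker≡v →
          contradiction (trans (sym iso) (trans (cong isolated (sym ker≡v)) (ker-isolated a))) λ ())))
      }

    -- If `h < t`, the vertex is used up and `freeCount` drops by one. Otherwise `freeCount` is
    -- unchanged and the left side is the maximum of `V` and 1, where 1 is available because `v`
    -- itself is empty.
    isolated-value : ∀ V → 1 + (V ∸ (1 ∸ (t ∸ h))) ≤ freeCount δ ⇔ V ≤ freeCount δ′
    isolated-value V with <-≤-connex h t
    ... | inj₁ h<t rewrite sym (freeCount-grow h<t) | m≤n⇒m∸n≡0 (m<n⇒0<n∸m h<t) = mk⇔ s≤s⁻¹ s≤s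
    ... | inj₂ t≤h rewrite freeCount-vanish t≤h | m≤n⇒m∸n≡0 t≤h = mk⇔
      (≤-trans (≤-trans (m≤n+m∸n V 1) ≤-refl))
      (λ V≤ → +-cancel V V≤ (freeCount-positive {δ} iso e))
      where
      +-cancel : ∀ V {F} → V ≤ F → 0 < F → 1 + (V ∸ 1) ≤ F
      +-cancel zero    V≤F 0<F = 0<F
      +-cancel (suc V) V≤F 0<F = V≤F

  -- A minimum is at most `freeCount δ` if and only if one of the options is. The initial value of
  -- the minimum stands for all isolated vertices at once, the other options for single kernel
  -- vertices.
  placeable⇔ : ∀ S {δ σ} → Represents δ σ → Placeable G t δ S ⇔ value S σ ≤ freeCount δ
  placeable⇔ S R = mk⇔ (sound S R) (complete S R)
    where
    open Equivalence

    option : Stack k → List (Stack k) → ℕ → ℕ → ℕ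
    option s S σ x = value S (move σ x (toℕ (colour s)) (height s))

    sound : ∀ S {δ σ} → Represents δ σ → Placeable G t δ S → value S σ ≤ freeCount δ
    sound []      R done = z≤n
    sound (s ∷ S) {δ} {σ} R (next x e p) with isolated x in iso
    ... | true  = ≤-trans (foldMin≤d _ (digit b m σ) (option s S σ) m)
                    (from (isolated-value {δ} iso e s (value S σ)) (sound S (isolated-represents iso e s R) p))
    ... | false with a , refl ← ker-complete iso =
      ≤-trans (foldMin≤y _ (digit b m σ) (option s S σ)
                (Fin.toℕ<n a) (trans (digit-at R a) (cong (code t) e)))
              (subst (value S _ ≤_) (freeCount-kernel R a s) (sound S (move-represents R a s) p))

    complete : ∀ S {δ σ} → Represents δ σ → value S σ ≤ freeCount δ → Placeable G t δ S
    complete []      R le = done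
    complete (s ∷ S) {δ} {σ} R le with foldMin≤⇒ _ (digit b m σ) (option s S σ) m le
    -- This option is at least 1, so an empty isolated vertex exists.
    ... | inj₁ d≤ with v , iso , e ← find-free δ (≤-trans (s≤s z≤n) d≤) =
      next v e (complete S (isolated-represents iso e s R) (to (isolated-value {δ} iso e s (value S σ)) d≤))
    ... | inj₂ (x , x<m , gx , yx) = next (ker a) (code≡0⇒ (trans (sym (digit-at R a)) (trans (cong (digit b m σ) a≡x) gx)))
        (complete S (move-represents R a s)
          (subst₂ (λ i F → value S (move σ i (toℕ (colour s)) (height s)) ≤ F) (sym a≡x) (sym (freeCount-kernel R a s)) yx))
      where
      a = fromℕ< x<m
      a≡x = Fin.toℕ-fromℕ< x<m

-- Terms for the arithmetic of codes

mulT : Term 2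
mulT = rec (var (# 0)) (lit 0) (bin plus (var (# 3)) (var (# 1)))

powT : Term 2
powT = rec (var (# 1)) (lit 1) (mulT · (var (# 2) ∷ var (# 1) ∷ []))

-- rec c u t, with t not using the two bound variables, is ifnz c t u.
modT : Term 2
modT = rec (var (# 0)) (lit 0)
  (rec (bin monus (var (# 3)) (bin plus (lit 1) (var (# 1)))) (lit 0) (bin plus (lit 1) (var (# 3))))

divT : Term 2
divT = rec (var (# 0)) (lit 0)
  (rec (bin monus (var (# 3)) (bin plus (lit 1) (modT · (var (# 0) ∷ var (# 3) ∷ []))))
       (bin plus (lit 1) (var (# 1))) (var (# 3)))

-- The comments name the arguments in order.

-- σ, v, m, b
digitT : Term 4
digitT = modT ·
  ( rec (bin monus (var (# 2)) (bin plus (lit 1) (var (# 1)))) (var (# 0))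
      (divT · (var (# 1) ∷ var (# 5) ∷ []))
  ∷ var (# 3) ∷ [])

distanceT : Term 2
distanceT = bin plus (bin monus (var (# 0)) (var (# 1))) (bin monus (var (# 1)) (var (# 0)))

-- u, σ, x, c, m, t, b
sameT : Term 7
sameT = bin monus (bin edge (var (# 2)) (var (# 0))) (distanceT ·
  ( (divT · ((digitT · (var (# 1) ∷ var (# 0) ∷ var (# 4) ∷ var (# 6) ∷ [])) ∷ var (# 5) ∷ []))
  ∷ var (# 3) ∷ []))

-- σ, x, c, m, t, b
collectT : Term 6
collectT = rec (var (# 3)) (lit 0) (bin plus
  (rec (sameT · (var (# 0) ∷ var (# 2) ∷ var (# 3) ∷ var (# 4) ∷ var (# 5) ∷ var (# 6) ∷ var (# 7) ∷ []))
       (lit 0)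
       (modT · ((digitT · (var (# 4) ∷ var (# 2) ∷ var (# 7) ∷ var (# 9) ∷ [])) ∷ var (# 8) ∷ [])))
  (var (# 1)))

-- v, σ, x, c, g, m, t, b, where g is the height of the grown stack
newDigitT : Term 8
newDigitT = rec (distanceT · (var (# 0) ∷ var (# 2) ∷ []))
  (rec (bin monus (var (# 6)) (var (# 4))) (lit 0)
       (bin plus (var (# 6)) (mulT · (var (# 5) ∷ var (# 8) ∷ []))))
  (rec (sameT · (var (# 2) ∷ var (# 3) ∷ var (# 4) ∷ var (# 5) ∷ var (# 7) ∷ var (# 8) ∷ var (# 9) ∷ []))
       (digitT · (var (# 3) ∷ var (# 2) ∷ var (# 7) ∷ var (# 9) ∷ []))
       (lit 0))

-- σ, x, c, h, m, t, b
moveT : Term 7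
moveT = rec (var (# 4)) (lit 0) (bin plus
  (newDigitT · ( var (# 0) ∷ var (# 2) ∷ var (# 3) ∷ var (# 4)
               ∷ bin plus (var (# 5))
                   (collectT · (var (# 2) ∷ var (# 3) ∷ var (# 4) ∷ var (# 6) ∷ var (# 7) ∷ var (# 8) ∷ []))
               ∷ var (# 6) ∷ var (# 7) ∷ var (# 8) ∷ []))
  (mulT · (var (# 1) ∷ var (# 8) ∷ [])))

-- k, t
baseT : Term 2
baseT = bin plus (lit 1) (mulT · (var (# 0) ∷ var (# 1) ∷ []))

-- k, t
thresholdT : Term 2
thresholdT = mulT · (var (# 0) ∷ (mulT · (lit 2 ∷ (mulT · (var (# 0) ∷ var (# 1) ∷ [])) ∷ [])) ∷ [])

module _ (O : ℕ → ℕ → ℕ) where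
  open Semantics O

  baseT-correct : ∀ k t → ⟦ baseT ⟧ (k ∷ t ∷ []) ≡ suc (k * t)
  baseT-correct k t = cong suc (mul≡* k t)

  thresholdT-correct : ∀ k t → ⟦ thresholdT ⟧ (k ∷ t ∷ []) ≡ k * (2 * (k * t))
  thresholdT-correct k t = trans (mul≡* k (mul 2 (mul k t))) (cong (k *_) (trans (mul≡* 2 (mul k t)) (cong (2 *_) (mul≡* k t))))

-- Reading the input lists

nth-++ˡ : ∀ {A : Set} {d : A} xs {ys i} → i < length xs → nth d (xs ++ ys) i ≡ nth d xs i
nth-++ˡ (x ∷ xs) {i = zero}  _         = refl
nth-++ˡ (x ∷ xs) {i = suc i} (s≤s i<l) = nth-++ˡ xs i<l

nth-++ʳ : ∀ {A : Set} {d : A} xs {ys} i → nth d (xs ++ ys) (length xs + i) ≡ nth d ys i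
nth-++ʳ []       i = refl
nth-++ʳ (x ∷ xs) i = nth-++ʳ xs i

nth-tabulate : ∀ {A : Set} {d : A} {n} (f : Fin n → A) i → nth d (tabulate f) (toℕ i) ≡ f i
nth-tabulate f zero    = refl
nth-tabulate f (suc i) = nth-tabulate (λ j → f (suc j)) i

nth-concat : ∀ {A : Set} {d : A} {n p} (rows : Fin p → List A) → (∀ u → length (rows u) ≡ n) →
             ∀ u {j} → j < n → nth d (concat (tabulate rows)) (toℕ u * n + j) ≡ nth d (rows u) j
nth-concat rows len zero    j<n = nth-++ˡ (rows zero) (subst (_ <_) (sym (len zero)) j<n)
nth-concat {d = d} {n} rows len (suc u) {j} j<n = begin
  nth d (rows zero ++ rest) (n + toℕ u * n + j)
    ≡⟨ cong (nth d (rows zero ++ rest)) (trans (+-assoc n _ j) (cong (_+ _) (sym (len zero)))) ⟩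
  nth d (rows zero ++ rest) (length (rows zero) + (toℕ u * n + j))
    ≡⟨ nth-++ʳ (rows zero) (toℕ u * n + j) ⟩
  nth d rest (toℕ u * n + j)
    ≡⟨ nth-concat (λ v → rows (suc v)) (λ v → len (suc v)) u j<n ⟩
  nth d (rows (suc u)) j ∎
  where
  open ≡-Reasoning
  rest = concat (tabulate λ v → rows (suc v))

drop-nth : ∀ {A : Set} {P : A → Set} xs {i} → ListAll.All P xs → i < length xs →
           ∃[ x ] P x × drop i xs ≡ x ∷ drop (suc i) xs × (∀ (f : A → ℕ) → nth 0 (map f xs) i ≡ f x)
drop-nth (x ∷ xs) {zero}  (p ∷ _)  _         = x , p , refl , λ f → refl
drop-nth (x ∷ xs) {suc i} (_ ∷ ps) (s≤s i<l) = drop-nth xs ps i<l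

-- The programs

-- Registers: 0 n, 1 |C|, 2 t, 3 |S|; 4 vertex u, 5 offset of its matrix row, 6 m,
-- 7 number of isolated vertices, 8 vertex v, 9 degree of u; 10 base b, 11 number B
-- of codes, 12 offset of the current table row, 13 stage, 14 and 15 colour and
-- height of the stack, 16 code σ, 17 minimum so far, 18 kernel vertex x; scratch
-- space from 19 on.  Arrays: 0, 1, 2 input, 3 matrix row offsets of the kernel
-- vertices, 4 kernel vertices, 5 table, whose row i belongs to the last i stacks.

choice entry stage : Program

choice =
  compile digitT (16 ∷ 18 ∷ 6 ∷ 10 ∷ []) 19 ⨾
  if≢0 (var 19) skip
    ( compile moveT (16 ∷ 18 ∷ 14 ∷ 15 ∷ 6 ∷ 2 ∷ 10 ∷ []) 19 ⨾
      17 ≔ var 17 ⊖ (var 17 ⊖ 5 ⟦ var 12 ⊕ var 19 ⟧) )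

entry =
  17 ≔ lit 1 ⊕ (5 ⟦ var 12 ⊕ var 16 ⟧ ⊖ (lit 1 ⊖ (var 2 ⊖ var 15))) ⨾
  for 18 6 choice ⨾
  5 ⟦ (var 12 ⊕ var 11) ⊕ var 16 ⟧≔ var 17

stage =
  14 ≔ 0 ⟦ var 3 ⊖ (lit 1 ⊕ var 13) ⟧ ⨾
  15 ≔ 1 ⟦ var 3 ⊖ (lit 1 ⊕ var 13) ⟧ ⨾
  for 16 11 entry ⨾
  12 ≔ var 12 ⊕ var 11

choiceCost entryCost stageCost : ℕ → ℕ
choiceCost N = costBound digitT N + (2 + (1 + (costBound moveT N + 9)))
entryCost  N = 13 + (forCost N (choiceCost N) + 7)
stageCost  N = 7 + (7 + (forCost N (entryCost N) + 4))

module Stages (O : ℕ → ℕ → ℕ) {k : ℕ} (S : List (Stack k)) (m t iso N : ℕ) (colours heights : ℕ → ℕ)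
              (k≤N : k ≤ N) (m≤N : m ≤ N) (t≤N : t ≤ N) (b≤N : suc (k * t) ≤ N) (B≤N : pow (suc (k * t)) m ≤ N) where

  private
    b B : ℕ
    b = suc (k * t)
    B = pow b m

  open Codes O m t b

  Frame : State → Set
  Frame τ = vars τ 2 ≡ t × vars τ 3 ≡ length S × vars τ 6 ≡ m × vars τ 7 ≡ iso × vars τ 10 ≡ b ×
            vars τ 11 ≡ B × arrays τ 0 ≡ colours × arrays τ 1 ≡ heights × HoldsEdges O τ

  frame-same : ∀ {σ τ} → SameBelow O 19 σ τ → Frame σ → Frame τ
  frame-same (sameBelow v refl) (e2 , e3 , e6 , e7 , e10 , e11 , rest) =
    trans (v (m≤m+n 3 16)) e2 , trans (v (m≤m+n 4 15)) e3 , trans (v (m≤m+n 7 12)) e6 , trans (v (m≤m+n 8 11)) e7 ,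
    trans (v (m≤m+n 11 8)) e10 , trans (v (m≤m+n 12 7)) e11 , rest

  move<B : ∀ {c} → c < k → ∀ σ x h → move σ x c h < B
  move<B c<k σ x h = encode<pow m λ {i} _ → newDigit< {k} refl c<k σ x h i

  module Stage (s : Stack k) (h≤N : height s ≤ N) (S′ : List (Stack k)) (o i : ℕ) where

    c h : ℕ
    c = toℕ (colour s)
    h = height s

    c≤N : c ≤ N
    c≤N = ≤-trans (<⇒≤ (Fin.toℕ<n (colour s))) k≤N

    Current : State → Set
    Current τ = Frame τ × vars τ 12 ≡ o × vars τ 14 ≡ c × vars τ 15 ≡ h × vars τ 13 ≡ i

    current-same : ∀ {σ τ} → SameBelow O 19 σ τ → Current σ → Current τ
    current-same s@(sameBelow v _) (F , e12 , e14 , e15 , e13) =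
      frame-same s F , trans (v (m≤m+n 13 6)) e12 , trans (v (m≤m+n 15 4)) e14 , trans (v (m≤m+n 16 3)) e15 ,
      trans (v (m≤m+n 14 5)) e13

    -- `row` is all of array 5, which stays fixed while the choices for one code are compared.
    module Entry (σ : ℕ) (σ<B : σ < B) (row : ℕ → ℕ) (row≡ : ∀ {e} → e < B → row (o + e) ≡ value S′ e) where

      best : ℕ → ℕ
      best = foldMin (1 + (value S′ σ ∸ (1 ∸ (t ∸ h)))) (digit b m σ) (λ x → value S′ (move σ x c h))

      option : ℕ → ℕ
      option x = best x ∸ (best x ∸ value S′ (move σ x c h))

      Best : ℕ → State → Set
      Best x τ = Current τ × vars τ 16 ≡ σ × vars τ 17 ≡ best x × arrays τ 5 ≡ row

      best-same : ∀ {x τ υ} → SameBelow O 19 τ υ → Best x τ → Best x υ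
      best-same s@(sameBelow v refl) (C , e16 , e17 , e5) =
        current-same s C , trans (v (m≤m+n 17 2)) e16 , trans (v (m≤m+n 18 1)) e17 , e5

      choice-t : ∀ {x τ} → x < m → vars τ 18 ≡ x → vars τ 6 ≡ m → Best x τ →
        Terminates choice τ
          (λ υ → vars υ 18 ≡ x × vars υ 6 ≡ m × Best (suc x) (setVar υ 18 (suc x))) (choiceCost N)
      choice-t {x} {τ} x<m e18 e6 I@(C@(F@(e2 , _ , _ , _ , e10 , _ , _ , _ , E) , _) , e16 , e17 , e5) =
        compute O digitT E
          (holds-∷ O (m≤m+n 17 2) e16 (holds-∷ O (m≤m+n 19 0) e18 (holds-∷ O (m≤m+n 7 12) e6
            (holds-∷ O (m≤m+n 11 8) e10 (holds-[] O)))))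
          (≤*-∷ σ≤N (≤*-∷ x≤N (≤*-∷ m≤N (≤*-∷ b≤N []≤*))))
        then λ {υ} (ed , s₁) →
        branch
          (λ d≢0 → skip-t
            ( trans (sameVars s₁ ≤-refl) e18 , trans (sameVars s₁ (m≤m+n 7 12)) e6
            , subst (λ a → Current υ × vars υ 16 ≡ σ × vars υ 17 ≡ a × arrays υ 5 ≡ row)
                (sym (ifnz-pos (best x) (option x) (n≢0⇒n>0 λ d≡0 → d≢0 (trans ed d≡0)))) (best-same {x} s₁ I) ))
          (λ d≡0 →
            let I′@(C′@(F′@(e2′ , _ , e6′ , _ , e10′ , _ , _ , _ , E′) , _ , e14′ , e15′ , _) , e16′ , _) = best-same {x} s₁ I
                e18′ = trans (sameVars s₁ ≤-refl) e18
            in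
            compute O moveT E′
              (holds-∷ O (m≤m+n 17 2) e16′ (holds-∷ O (m≤m+n 19 0) e18′ (holds-∷ O (m≤m+n 15 4) e14′
                (holds-∷ O (m≤m+n 16 3) e15′ (holds-∷ O (m≤m+n 7 12) e6′ (holds-∷ O (m≤m+n 3 16) e2′
                  (holds-∷ O (m≤m+n 11 8) e10′ (holds-[] O))))))))
              (≤*-∷ σ≤N (≤*-∷ x≤N (≤*-∷ c≤N (≤*-∷ h≤N (≤*-∷ m≤N (≤*-∷ t≤N (≤*-∷ b≤N []≤*)))))))
            then λ {φ} (em , s₂) →
            let I″@(C″@(_ , e12″ , _) , e16″ , e17″ , e5″) = best-same {x} s₂ I′
            in assign
              ( trans (sameVars s₂ ≤-refl) e18′ , trans (sameVars s₂ (m≤m+n 7 12)) e6′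
              , C″ , e16″
              , trans (cong₂ (λ a y → a ∸ (a ∸ y)) e17″
                        (trans (cong₂ (λ α a → α a) e5″ (cong₂ _+_ e12″ em))
                               (row≡ (move<B (Fin.toℕ<n (colour s)) σ x h))))
                      (sym (ifnz-zero (best x) (option x) (trans (sym ed) d≡0)))
              , e5″ ))
        where
        σ≤N : σ ≤ N
        σ≤N = ≤-trans (<⇒≤ σ<B) B≤N
        x≤N : x ≤ N
        x≤N = ≤-trans (<⇒≤ x<m) m≤N

    Row : ℕ → State → Set
    Row σ τ = Current τ × (∀ {e} → e < B → arrays τ 5 (o + e) ≡ value S′ e) ×
              (∀ {e} → e < σ → arrays τ 5 (o + B + e) ≡ value (s ∷ S′) e)

    entry-t : ∀ {σ τ} → σ < B → vars τ 16 ≡ σ → vars τ 11 ≡ B → Row σ τ →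
      Terminates entry τ
        (λ υ → vars υ 16 ≡ σ × vars υ 11 ≡ B × Row (suc σ) (setVar υ 16 (suc σ))) (entryCost N)
    entry-t {σ} {τ} σ<B e16 e11 (C@((e2 , _ , e6 , _) , e12 , e14 , e15 , e13) , old , new) =
      assign {Q = λ υ → Best 0 (setVar υ 18 0) × vars υ 6 ≡ m}
        ( ( C , e16
          , cong₂ (λ V d → 1 + (V ∸ (1 ∸ d)))
              (trans (cong (arrays τ 5) (cong₂ _+_ e12 e16)) (old σ<B)) (cong₂ _∸_ e2 e15)
          , refl )
        , e6 )
      then λ (I , e6) →
      weaken id (forCost-monoˡ (choiceCost N) m≤N) (for-t (λ ()) Best choice-t e6 I)
      then λ {υ} (C′@((_ , _ , _ , _ , _ , e11′ , _) , e12′ , _) , e16′ , e17′ , e5′) →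
      let index : eval υ ((var 12 ⊕ var 11) ⊕ var 16) ≡ o + B + σ
          index = cong₂ _+_ (cong₂ _+_ e12′ e11′) e16′
      in store
        ( e16′ , e11′ , C′
        , (λ {e} e<B → trans
            -- Cells of the old row lie below `o + B`, hence below the cell just written.
            (update-other (arrays υ 5) _ λ o+e≡ → <⇒≢ (<-≤-trans (+-monoʳ-< o e<B) (m≤m+n (o + B) σ)) (trans o+e≡ index))
            (trans (cong (λ α → α (o + e)) e5′) (old e<B)))
        , λ {e} e<1+σ → written υ e5′ e17′ index (m≤n⇒m<n∨m≡n (≤-pred e<1+σ)) )
      where
      open Entry σ σ<B (arrays τ 5) old

      written : ∀ υ {i e} → arrays υ 5 ≡ arrays τ 5 → vars υ 17 ≡ best m → i ≡ o + B + σ → e < σ ⊎ e ≡ σ →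
                (arrays υ 5 [ i ↦ vars υ 17 ]) (o + B + e) ≡ value (s ∷ S′) e
      written υ {i} {e} e5 e17 refl (inj₁ e<σ) = trans
        (update-other (arrays υ 5) _ (<⇒≢ (+-monoʳ-< (o + B) e<σ)))
        (trans (cong (λ α → α (o + B + e)) e5) (new e<σ))
      written υ e5 e17 refl (inj₂ refl) = trans (update-same (arrays υ 5) _ _) e17

  Stages : ℕ → State → Set
  Stages i τ = Frame τ × ∀ {e} → e < B → arrays τ 5 (vars τ 12 + e) ≡ value (drop (length S ∸ i) S) e

  module _ (low : ListAll.All (λ s → height s ≤ N) S)
           (colours≡ : ∀ i → colours i ≡ nth 0 (map (λ s → toℕ (colour s)) S) i)
           (heights≡ : ∀ i → heights i ≡ nth 0 (map height S) i) where

    -- The stages run backwards through `S`: the current row belongs to the suffix from `suc j`, and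
    -- the stack at `j` is put in front of it.
    stage-t : ∀ {i τ} → i < length S → vars τ 13 ≡ i → vars τ 3 ≡ length S → Stages i τ →
      Terminates stage τ
        (λ υ → vars υ 13 ≡ i × vars υ 3 ≡ length S × Stages (suc i) (setVar υ 13 (suc i))) (stageCost N)
    stage-t {i} {τ} i<l e13 e3 (F@(_ , _ , _ , _ , _ , _ , e0 , _) , old) =
      step (drop-nth S low (∸-monoʳ-< z<s i<l))
      where
      o j : ℕ
      o = vars τ 12
      j = length S ∸ suc i

      1+j : suc j ≡ length S ∸ i
      1+j = sym (+-∸-assoc 1 i<l)

      step : (∃[ s ] height s ≤ N × drop j S ≡ s ∷ drop (suc j) S × (∀ (f : Stack k → ℕ) → nth 0 (map f S) j ≡ f s)) →
        Terminates stage τ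
          (λ υ → vars υ 13 ≡ i × vars υ 3 ≡ length S × Stages (suc i) (setVar υ 13 (suc i))) (stageCost N)
      step (s , h≤N , drop≡ , nth≡) =
        assign {Q = λ υ → Frame υ × vars υ 12 ≡ o × vars υ 14 ≡ toℕ (colour s) × vars υ 13 ≡ i × arrays υ 5 ≡ arrays τ 5}
          (F , refl , trans (cong₂ (λ α a → α a) e0 (cong₂ (λ a b → a ∸ suc b) e3 e13)) (trans (colours≡ j) (nth≡ _)) , e13 , refl)
        then λ {υ} (F@(_ , e3 , _ , _ , _ , _ , _ , e1 , _) , e12 , e14 , e13 , e5) →
        assign {Q = λ φ → Current φ × arrays φ 5 ≡ arrays τ 5}
          ( (F , e12 , e14 , trans (cong₂ (λ α a → α a) e1 (cong₂ (λ a b → a ∸ suc b) e3 e13)) (trans (heights≡ j) (nth≡ _)) , e13)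
          , e5 )
        then λ {φ} (C@((_ , _ , _ , _ , _ , e11 , _) , _) , e5) →
        weaken id (forCost-monoˡ (entryCost N) B≤N)
          (for-t (λ ()) Row entry-t e11
            (C , (λ {e} e<B → trans (cong (λ α → α (o + e)) e5) (trans (old e<B) (cong (λ j → value (drop j S) e) (sym 1+j)))) , λ ()))
        then λ {χ} ((F@(_ , e3 , _ , _ , _ , e11 , _) , e12 , _ , _ , e13) , _ , new) →
        assign
          ( e13 , e3 , F
          , λ {e} e<B → trans (cong₂ (λ o B → arrays χ 5 (o + B + e)) e12 e11)
                              (trans (new e<B) (cong (λ S → value S e) (sym drop≡))) )
        where open Stage s h≤N (drop (suc j) S) o i

-- Listing the non-isolated vertices

scanRow scan : Program

scanRow =
  9 ≔ lit 0 ⨾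
  for 8 0 (9 ≔ 2 ⟦ var 5 ⊕ var 8 ⟧ ⊕ var 9) ⨾
  if≢0 (var 9)
    (3 ⟦ var 6 ⟧≔ var 5 ⨾ 4 ⟦ var 6 ⟧≔ var 4 ⨾ 6 ≔ lit 1 ⊕ var 6)
    (7 ≔ lit 1 ⊕ var 7) ⨾
  5 ≔ var 0 ⊕ var 5

scan = for 4 0 scanRow

rowCost : ℕ → ℕ
rowCost n = 2 + (forCost n 7 + (16 + 4))

module Scan (n : ℕ) (matrix : ℕ → ℕ) where

  degree : ℕ → ℕ
  degree u = fold n 0 λ v d → matrix (u * n + v) + d

  isoCount : ℕ → ℕ
  isoCount u = fold u 0 λ v a → ifnz (degree v) 0 1 + a

  -- Row offsets are kept beside the vertices so that an edge test only adds two numbers. From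
  -- `increasing` comes the injectivity of the kernel's enumeration.
  record Listed (u m : ℕ) (rowAt vertexAt : ℕ → ℕ) : Set where
    field
      vertex<u   : ∀ {i} → i < m → vertexAt i < u
      degree≢0   : ∀ {i} → i < m → degree (vertexAt i) ≢ 0
      row≡       : ∀ {i} → i < m → rowAt i ≡ vertexAt i * n
      increasing : ∀ {i j} → i < j → j < m → vertexAt i < vertexAt j
      complete   : ∀ {v} → v < u → degree v ≢ 0 → ∃[ i ] i < m × vertexAt i ≡ v

  open Listed public

  <suc-elim : ∀ {m i} (P : ℕ → Set) → (∀ {i} → i < m → P i) → P m → i < suc m → P i
  <suc-elim P below at i<1+m with m≤n⇒m<n∨m≡n (≤-pred i<1+m)
  ... | inj₁ i<m  = below i<m
  ... | inj₂ refl = at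

  listed-add : ∀ {u m ρ ν} → Listed u m ρ ν → degree u ≢ 0 →
               Listed (suc u) (suc m) (ρ [ m ↦ u * n ]) (ν [ m ↦ u ])
  listed-add {u} {m} {ρ} {ν} L d≢0 = record
    { vertex<u   = <suc-elim (λ i → ν′ i < suc u)
        (λ i<m → subst (_< suc u) (sym (old i<m)) (m<n⇒m<1+n (vertex<u L i<m)))
        (subst (_< suc u) (sym new) ≤-refl)
    ; degree≢0   = <suc-elim (λ i → degree (ν′ i) ≢ 0)
        (λ i<m → subst (λ v → degree v ≢ 0) (sym (old i<m)) (degree≢0 L i<m))
        (subst (λ v → degree v ≢ 0) (sym new) d≢0)
    ; row≡       = <suc-elim (λ i → ρ′ i ≡ ν′ i * n)
        (λ i<m → trans (update-other ρ _ (<⇒≢ i<m)) (trans (row≡ L i<m) (cong (_* n) (sym (old i<m)))))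
        (trans (update-same ρ m _) (cong (_* n) (sym new)))
    ; increasing = λ {i} i<j j<1+m → <suc-elim (λ j → i < j → ν′ i < ν′ j)
        (λ j<m i<j → subst₂ _<_ (sym (old (<-trans i<j j<m))) (sym (old j<m)) (increasing L i<j j<m))
        (λ i<m → subst₂ _<_ (sym (old i<m)) (sym new) (vertex<u L i<m))
        j<1+m i<j
    ; complete   = <suc-elim (λ v → degree v ≢ 0 → ∃[ i ] i < suc m × ν′ i ≡ v)
        (λ v<u d≢0 → let i , i<m , e = complete L v<u d≢0 in i , m<n⇒m<1+n i<m , trans (old i<m) e)
        (λ _ → m , ≤-refl , new)
    }
    where
    ρ′ ν′ : ℕ → ℕ
    ρ′ = ρ [ m ↦ u * n ]
    ν′ = ν [ m ↦ u ]
    old : ∀ {i} → i < m → ν′ i ≡ ν i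
    old i<m = update-other ν u (<⇒≢ i<m)
    new : ν′ m ≡ u
    new = update-same ν m u

  listed-skip : ∀ {u m ρ ν} → Listed u m ρ ν → degree u ≡ 0 → Listed (suc u) m ρ ν
  listed-skip {u} {m} {ρ} {ν} L d≡0 = record
    { vertex<u   = λ i<m → m<n⇒m<1+n (vertex<u L i<m)
    ; degree≢0   = degree≢0 L
    ; row≡       = row≡ L
    ; increasing = increasing L
    ; complete   = <suc-elim (λ v → degree v ≢ 0 → ∃[ i ] i < m × ν i ≡ v)
        (complete L) (λ d≢0 → contradiction d≡0 d≢0)
    }

  module _ (k t l : ℕ) (colours heights : ℕ → ℕ) where

    Initial : State → Set
    Initial τ = vars τ 0 ≡ n × vars τ 1 ≡ k × vars τ 2 ≡ t × vars τ 3 ≡ l × vars τ 12 ≡ 0 ×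
                arrays τ 0 ≡ colours × arrays τ 1 ≡ heights × arrays τ 2 ≡ matrix × arrays τ 5 ≡ λ _ → 0

    Scanned : ℕ → State → Set
    Scanned u τ = Initial τ × vars τ 5 ≡ u * n × vars τ 7 ≡ isoCount u ×
                  Listed u (vars τ 6) (arrays τ 3) (arrays τ 4)

    scanRow-t : ∀ {u τ} → u < n → vars τ 4 ≡ u → vars τ 0 ≡ n → Scanned u τ →
      Terminates scanRow τ
        (λ υ → vars υ 4 ≡ u × vars υ 0 ≡ n × Scanned (suc u) (setVar υ 4 (suc u))) (rowCost n)
    scanRow-t {u} {τ} u<n e4 e0 I =
      assign {Q = Row 0} (I , e4 , refl)
      then λ (I , e4 , e9) →
      for-t (λ ()) Row
        (λ { _ e8 e0 (I@((_ , _ , _ , _ , _ , _ , _ , e2 , _) , e5 , _) , e4 , e9) → assign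
          (e8 , e0 , I , e4 , cong₂ _+_ (cong₂ (λ α i → α i) e2 (cong₂ _+_ e5 e8)) e9) })
        (proj₁ (proj₁ I)) (I , e4 , e9)
      then λ {υ} ((J , e5 , e7 , L) , e4 , e9) →
      branch {Q = λ φ → Initial φ × vars φ 4 ≡ u × vars φ 5 ≡ u * n × vars φ 7 ≡ isoCount (suc u) ×
                        Listed (suc u) (vars φ 6) (arrays φ 3) (arrays φ 4)}
        (λ d≢0 →
          let deg≢0 = λ z → d≢0 (trans e9 z) in
          store {Q = λ φ → Initial φ × vars φ 4 ≡ u × vars φ 5 ≡ u * n × vars φ 7 ≡ isoCount (suc u) ×
                           vars φ 6 ≡ vars υ 6 × arrays φ 3 ≡ arrays υ 3 [ vars υ 6 ↦ u * n ] × arrays φ 4 ≡ arrays υ 4}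
            ( J , e4 , e5 , trans e7 (cong (_+ isoCount u) (sym (ifnz-pos 0 1 (n≢0⇒n>0 deg≢0)))) , refl
            , cong (λ a → arrays υ 3 [ vars υ 6 ↦ a ]) e5 , refl )
          then λ {φ} (J , e4 , e5 , e7 , e6 , a3 , a4) →
          store {Q = λ χ → Initial χ × vars χ 4 ≡ u × vars χ 5 ≡ u * n × vars χ 7 ≡ isoCount (suc u) ×
                           vars χ 6 ≡ vars υ 6 × arrays χ 3 ≡ arrays υ 3 [ vars υ 6 ↦ u * n ] ×
                           arrays χ 4 ≡ arrays υ 4 [ vars υ 6 ↦ u ]}
            (J , e4 , e5 , e7 , e6 , a3 , cong₂ _$_ (cong₂ (λ α i → α [ i ↦_]) a4 e6) e4)
          then λ (J , e4 , e5 , e7 , e6 , a3 , a4) →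
          assign (J , e4 , e5 , e7 , listed-cong (cong suc e6) a3 a4 (listed-add L deg≢0)))
        (λ d≡0 →
          let deg≡0 = trans (sym e9) d≡0 in
          assign (J , e4 , e5 , cong₂ _+_ (sym (ifnz-zero 0 1 deg≡0)) e7 , listed-skip L deg≡0))
      then λ (J , e4 , e5 , e7 , L) →
      assign (e4 , proj₁ J , J , cong₂ _+_ (proj₁ J) e5 , e7 , L)
      where
      Row : ℕ → State → Set
      Row v τ = Scanned u τ × vars τ 4 ≡ u × vars τ 9 ≡ fold v 0 (λ v d → matrix (u * n + v) + d)

      listed-cong : ∀ {u m m′ ρ ρ′ ν ν′} → m ≡ m′ → ρ ≡ ρ′ → ν ≡ ν′ → Listed u m′ ρ′ ν′ → Listed u m ρ ν
      listed-cong refl refl refl L = L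

    scan-t : ∀ {τ} → Initial τ → vars τ 5 ≡ 0 → vars τ 6 ≡ 0 → vars τ 7 ≡ 0 →
             Terminates scan τ (Scanned n) (forCost n (rowCost n))
    scan-t {τ} I e5 e6 e7 = for-t (λ ()) Scanned scanRow-t (proj₁ I)
      (I , e5 , e7 , subst (λ m → Listed 0 m (arrays τ 3) (arrays τ 4)) (sym e6) (record
        { vertex<u = λ () ; degree≢0 = λ () ; row≡ = λ () ; increasing = λ _ () ; complete = λ () }))

module _ {n : ℕ} (G : Graph n) where

  open Scan n (nth 0 (adjacencyMatrix G))

  matrix-adj : ∀ u v → nth 0 (adjacencyMatrix G) (toℕ u * n + toℕ v) ≡ (if adj G u v then 1 else 0)
  matrix-adj u v = trans
    (nth-concat (λ u → tabulate λ v → if adj G u v then 1 else 0) (λ u → length-tabulate _) u (Fin.toℕ<n v))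
    (nth-tabulate (λ v → if adj G u v then 1 else 0) v)

  degree≡ : ∀ u → degree (toℕ u) ≡ sum (tabulate λ v → if adj G u v then 1 else 0)
  degree≡ u = fold-sum _ _ (matrix-adj u)

  degree≡0⇒ : ∀ {u} → degree (toℕ u) ≡ 0 → ∀ v → adj G u v ≡ false
  degree≡0⇒ {u} d≡0 v with adj G u v in eq
  ... | false = refl
  ... | true  = contradiction (trans (sym (degree≡ u)) d≡0) (>⇒≢ (sum-lower {1} _ (λ _ → v) (λ { {zero} {zero} _ → refl })
    λ _ → ≤-reflexive (sym (if-true eq))))

  degree≢0⇒ : ∀ {u} → degree (toℕ u) ≢ 0 → ∃[ v ] adj G u v ≡ true
  degree≢0⇒ {u} d≢0 with Fin.any? (λ v → adj G u v Bool.≟ true)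
  ... | yes adjacent = adjacent
  ... | no none = contradiction (trans (degree≡ u) (sum-zero _ λ v →
    if-false (Bool.¬-not λ a → none (v , a)))) d≢0

  module _ {m ρ ν} (L : Listed n m ρ ν) where

    private
      ker : Fin m → Fin n
      ker i = fromℕ< (vertex<u L (Fin.toℕ<n i))

      toℕ-ker : ∀ i → toℕ (ker i) ≡ ν (toℕ i)
      toℕ-ker i = Fin.toℕ-fromℕ< (vertex<u L (Fin.toℕ<n i))

      degree-ker : ∀ i → degree (toℕ (ker i)) ≢ 0
      degree-ker i = degree≢0 L (Fin.toℕ<n i) ∘ trans (cong degree (sym (toℕ-ker i)))

      ker-injective : Injective _≡_ _≡_ ker
      ker-injective {i} {j} eq with Fin.<-cmp i j
      ... | tri≈ _ i≡j _ = i≡j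
      ... | tri< i<j _ _ = contradiction (cong toℕ eq) (<⇒≢ (subst₂ _<_ (sym (toℕ-ker i)) (sym (toℕ-ker j))
                             (increasing L i<j (Fin.toℕ<n j))))
      ... | tri> _ _ j<i = contradiction (cong toℕ (sym eq)) (<⇒≢ (subst₂ _<_ (sym (toℕ-ker j)) (sym (toℕ-ker i))
                             (increasing L j<i (Fin.toℕ<n i))))

    kernel : Kernel G m
    kernel = record
      { isolated      = λ v → does (degree (toℕ v) ≟ 0)
      ; isolated-adj  = λ {v} iso → degree≡0⇒ (does-true (degree (toℕ v) ≟ 0) iso)
      ; ker           = ker
      ; ker-injective = ker-injective
      ; ker-isolated  = λ a → dec-false (degree (toℕ (ker a)) ≟ 0) (degree-ker a)
      ; ker-complete  = λ {v} iso →
          let i , i<m , e = complete L (Fin.toℕ<n v) (does-false (degree (toℕ v) ≟ 0) iso)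
          in fromℕ< i<m , Fin.toℕ-injective (trans (toℕ-ker _) (trans (cong ν (Fin.toℕ-fromℕ< i<m)) e))
      }
      where
      does-true : ∀ {P : Set} (P? : Dec P) → does P? ≡ true → P
      does-true (yes p) _ = p
      does-false : ∀ {P : Set} (P? : Dec P) → does P? ≡ false → P → ⊥
      does-false (no ¬p) _ = ¬p

    kernel-adj : ∀ a u → nth 0 (adjacencyMatrix G) (ρ (toℕ a) + ν (toℕ u)) ≡ (if adj G (ker a) (ker u) then 1 else 0)
    kernel-adj a u = trans
      (cong (nth 0 (adjacencyMatrix G)) (cong₂ _+_
        (trans (row≡ L (Fin.toℕ<n a)) (cong (_* n) (sym (toℕ-ker a)))) (sym (toℕ-ker u))))
      (matrix-adj (ker a) (ker u))

    placeable-large : ∀ {k} t (S : List (Stack k)) → k * (2 * (k * t)) < m → Placeable G t emptyConfig S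
    placeable-large t S lt = placeable-many G t ker ker-injective (degree≢0⇒ ∘ degree-ker) lt S

-- The complete program

dp hard main : Program

dp =
  compile baseT (1 ∷ 2 ∷ []) 19 ⨾ 10 ≔ var 19 ⨾
  compile powT (10 ∷ 6 ∷ []) 19 ⨾ 11 ≔ var 19 ⨾
  for 13 3 stage ⨾
  -- The first cell of the last row belongs to code 0, the empty kernel. The result is 1 exactly if
  -- its entry does not exceed the number of isolated vertices.
  0 ≔ lit 1 ⊖ (5 ⟦ var 12 ⟧ ⊖ var 7)

hard =
  scan ⨾
  compile thresholdT (1 ∷ 2 ∷ []) 19 ⨾
  if≢0 (var 6 ⊖ var 19) (0 ≔ lit 1) dp

main = if≢0 (var 3 ⊖ var 0) hard (0 ≔ lit 1)

-- Bounds for the arguments of terms: the first covers `k`, `t` and the kernel size, the second also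
-- the base, the third also the number of codes. The last comes from `valueBound powT`, which only
-- requires a bound on the exponent.
kernelBound sizeBound codeBound : ℕ → ℕ → ℕ
kernelBound k t = k + (t + k * (2 * (k * t)))
sizeBound   k t = kernelBound k t + suc (k * t)
codeBound   k t = sizeBound k t + valueBound powT (sizeBound k t)

-- The same sum serves for the number of steps and for the coefficient of |S|² that bounds it.
totalCost : (base size threshold rows stages : ℕ) → ℕ
totalCost base size threshold rows stages =
  4 + (rows + (threshold + (4 + (2 + (base + (2 + (size + (2 + (stages + 7)))))))))

module _ (I : Instance) where

  private
    n k t l : ℕ
    n = numVertices I
    k = numColours I
    t = threshold I
    l = length (stacks I)

    G = graph I
    S = stacks I
    C = nth 0 (map (λ s → toℕ (colour s)) S)
    H = nth 0 (map height S)

    k≤ : k ≤ kernelBound k t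
    k≤ = m≤m+n k _
    t≤ : t ≤ kernelBound k t
    t≤ = ≤-trans (m≤m+n t _) (m≤n+m _ k)

  open Scan n (nth 0 (adjacencyMatrix G))

  Decides : State → Set
  Decides τ = Accepting τ ⇔ FittingHexasort I

  accept : ∀ {τ} → FittingHexasort I → Decides (setVar τ 0 1)
  accept p = mk⇔ (λ _ → p) (λ _ ())

  module _ {m ρ ν} (L : Listed n m ρ ν) (m≤ : m ≤ k * (2 * (k * t))) where

    private
      b B N : ℕ
      b = suc (k * t)
      B = pow b m
      N = codeBound k t

      O : ℕ → ℕ → ℕ
      O x u = nth 0 (adjacencyMatrix G) (ρ x + ν u)

      kernel≤ : kernelBound k t ≤ N
      kernel≤ = ≤-trans (m≤m+n _ (suc (k * t))) (m≤m+n _ _)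

      m≤′ : m ≤ kernelBound k t
      m≤′ = ≤-trans m≤ (≤-trans (m≤n+m _ t) (m≤n+m _ k))

      b≤ : b ≤ sizeBound k t
      b≤ = m≤n+m b _

      powArgs : b ∷ m ∷ [] ≤* sizeBound k t
      powArgs = ≤*-∷ b≤ (≤*-∷ (≤-trans m≤′ (m≤m+n _ _)) []≤*)

      open Codes O m t b using (value)
      open Stages O S m t (isoCount n) N C H (≤-trans k≤ kernel≤) (≤-trans m≤′ kernel≤) (≤-trans t≤ kernel≤)
        (≤-trans b≤ (m≤m+n _ _)) (≤-trans (value≤ O powT powArgs) (m≤n+m _ _))

      0<B : 0 < B
      0<B = ≤-<-trans z≤n (encode<pow {b} {λ _ → 0} m λ _ → s≤s z≤n)

      value⇔ : Placeable G t emptyConfig S ⇔ value S 0 ≤ isoCount n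
      value⇔ = subst (λ F → Placeable G t emptyConfig S ⇔ value S 0 ≤ F) (sym count)
        (placeable⇔ G t (kernel G L) O (kernel-adj G L) S (record { short = λ _ → nothing ; digit-at = λ a → cong (λ q → mod q b) (div-zero (m ∸ suc (toℕ a))) }))
        where
        div-zero : ∀ j → fold j 0 (λ _ a → div a b) ≡ 0
        div-zero zero    = refl
        div-zero (suc j) = cong (λ a → div a b) (div-zero j)

        indicator : ∀ d → ifnz d 0 1 ≡ (if does (d ≟ 0) ∧ true then 1 else 0)
        indicator zero    = refl
        indicator (suc _) = refl

        count : isoCount n ≡ freeCount {k = k} G t (kernel G L) O (kernel-adj G L) emptyConfig
        count = fold-sum {n} (λ v → ifnz (degree v) 0 1) _ λ v → indicator (degree (toℕ v))

      decides : ∀ {V} → V ≡ value S 0 → (1 ∸ (V ∸ isoCount n) ≢ 0) ⇔ FittingHexasort I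
      decides {V} refl = mk⇔
        (λ ≢0 → from value⇔ (m∸n≡0⇒m≤n (n<1⇒n≡0 (m∸n≢0⇒n<m ≢0))))
        (λ p → subst (λ a → 1 ∸ a ≢ 0) (sym (m≤n⇒m∸n≡0 (to value⇔ p))) λ ())
        where open Equivalence

    dp-t : ∀ {τ} → Initial k t l C H τ → vars τ 6 ≡ m → vars τ 7 ≡ isoCount n →
           arrays τ 3 ≡ ρ → arrays τ 4 ≡ ν →
           Terminates dp τ Decides (costBound baseT (kernelBound k t) + (2 + (costBound powT (sizeBound k t) + (2 + (forCost l (stageCost N) + 7)))))
    dp-t {τ} I₀@(e0 , e1 , e2 , e3 , e12 , a0 , a1 , a2 , a5) e6 e7 a3 a4 =
      compute O baseT E (holds-∷ O (m≤m+n 2 17) e1 (holds-∷ O (m≤m+n 3 16) e2 (holds-[] O)))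
        (≤*-∷ k≤ (≤*-∷ t≤ []≤*))
      then λ {υ} (eb , s) →
      let v : ∀ {q} → q < 19 → vars υ q ≡ vars τ q
          v = sameVars s
          a : arrays υ ≡ arrays τ
          a = sameArrays s
      in
      assign {Q = λ φ → vars φ 10 ≡ b × Ready φ}
        ( trans eb (baseT-correct O k t)
        , trans (v (m≤m+n 3 16)) e2 , trans (v (m≤m+n 4 15)) e3 , trans (v (m≤m+n 7 12)) e6
        , trans (v (m≤m+n 8 11)) e7 , trans (v (m≤m+n 13 6)) e12
        , trans (cong (λ α → α 0) a) a0 , trans (cong (λ α → α 1) a) a1 , trans (cong (λ α → α 5) a) a5
        , edges-same O E s )
      then λ {υ} (e10 , e2 , e3 , e6 , e7 , e12 , a0 , a1 , a5 , E) →
      compute O powT E (holds-∷ O (m≤m+n 11 8) e10 (holds-∷ O (m≤m+n 7 12) e6 (holds-[] O))) powArgs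
      then λ {φ} (eB , s) →
      let v : ∀ {q} → q < 19 → vars φ q ≡ vars υ q
          v = sameVars s
          a : arrays φ ≡ arrays υ
          a = sameArrays s
      in
      assign {Q = λ χ → vars χ 3 ≡ l × Stages 0 (setVar χ 13 0)}
        ( trans (v (m≤m+n 4 15)) e3
        , ( trans (v (m≤m+n 3 16)) e2 , trans (v (m≤m+n 4 15)) e3 , trans (v (m≤m+n 7 12)) e6
          , trans (v (m≤m+n 8 11)) e7 , trans (v (m≤m+n 11 8)) e10 , eB
          , trans (cong (λ α → α 0) a) a0 , trans (cong (λ α → α 1) a) a1 , edges-same O E s )
        -- Row 0 is the untouched array: its zeros are the values for the empty sequence.
        , λ {e} _ → trans (cong (λ α → α 5 (vars φ 12 + e)) a) (trans (cong (λ α → α (vars φ 12 + e)) a5)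
            (cong (λ S → value S e) (sym (drop-all l S ≤-refl)))) )
      then λ (e3 , J) →
      for-t (λ ()) Stages
        (stage-t (ListAll.map (λ h≤t → ≤-trans h≤t (≤-trans t≤ kernel≤)) (heights≤threshold I)) (λ _ → refl) (λ _ → refl))
        e3 J
      then λ {χ} ((_ , _ , _ , e7 , _) , row) →
      assign (subst (λ i → (1 ∸ (arrays χ 5 (vars χ 12) ∸ i) ≢ 0) ⇔ FittingHexasort I) (sym e7)
        (decides (trans (cong (arrays χ 5) (sym (+-identityʳ (vars χ 12))))
          (trans (row 0<B) (cong (λ i → value (drop i S) 0) (n∸n≡0 l))))))
      where
      Ready : State → Set
      Ready φ = vars φ 2 ≡ t × vars φ 3 ≡ l × vars φ 6 ≡ m × vars φ 7 ≡ isoCount n × vars φ 12 ≡ 0 ×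
                arrays φ 0 ≡ C × arrays φ 1 ≡ H × (arrays φ 5 ≡ λ _ → 0) × HoldsEdges O φ
      E : HoldsEdges O τ
      E x u rewrite a2 | a3 | a4 = refl

  hard-t : Terminates hard (input I) Decides
             (forCost n (rowCost n) + (costBound thresholdT (kernelBound k t) + (4 + (2 +
               (costBound baseT (kernelBound k t) + (2 + (costBound powT (sizeBound k t) + (2 +
               (forCost l (stageCost (codeBound k t)) + 7)))))))))
  hard-t =
    scan-t k t l C H (refl , refl , refl , refl , refl , refl , refl , refl , refl) refl refl refl
    then λ {τ} ((e0 , e1 , e2 , e3 , e12 , a0 , a1 , a2 , a5) , _ , e7 , L) →
    let O : ℕ → ℕ → ℕ
        O x u = arrays τ 2 (arrays τ 3 x + arrays τ 4 u)
    in
    compute O thresholdT (λ _ _ → refl) (holds-∷ O (m≤m+n 2 17) e1 (holds-∷ O (m≤m+n 3 16) e2 (holds-[] O)))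
      (≤*-∷ k≤ (≤*-∷ t≤ []≤*))
    then λ {υ} (e19 , s) →
    let v : ∀ {q} → q < 19 → vars υ q ≡ vars τ q
        v = sameVars s
        a : ∀ i → arrays υ i ≡ arrays τ i
        a i = cong (λ α → α i) (sameArrays s)
        e6 = v (m≤m+n 7 12)
        threshold≡ = trans e19 (thresholdT-correct O k t)
    in
    branch
      (λ above → assign (accept {υ} (placeable-large G L t S
        (subst₂ _<_ threshold≡ e6 (m∸n≢0⇒n<m above)))))
      (λ below → dp-t L (subst₂ _≤_ e6 threshold≡ (m∸n≡0⇒m≤n below))
        ( trans (v (m≤m+n 1 18)) e0 , trans (v (m≤m+n 2 17)) e1 , trans (v (m≤m+n 3 16)) e2
        , trans (v (m≤m+n 4 15)) e3 , trans (v (m≤m+n 13 6)) e12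
        , trans (a 0) a0 , trans (a 1) a1 , trans (a 2) a2 , trans (a 5) a5 )
        e6 (trans (v (m≤m+n 8 11)) e7) (a 3) (a 4))

-- The quadratic bound

forCost≤ : ∀ {n l} T → n ≤ l → 1 ≤ l → forCost n T ≤ (14 + T) * l
forCost≤ {n} {l} T n≤l 1≤l = begin
  6 + n * (4 + (T + 4))     ≡⟨ cong (λ a → 6 + n * (4 + a)) (+-comm T 4) ⟩
  6 + n * (8 + T)           ≤⟨ +-mono-≤ (≤-trans (≤-reflexive (sym (*-identityʳ 6))) (*-monoʳ-≤ 6 1≤l)) (*-monoˡ-≤ (8 + T) n≤l) ⟩
  6 * l + l * (8 + T)       ≡⟨ cong (6 * l +_) (*-comm l (8 + T)) ⟩
  6 * l + (8 + T) * l       ≡⟨ *-distribʳ-+ l 6 (8 + T) ⟨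
  (14 + T) * l              ∎
  where open ≤-Reasoning

-- A record lets the coefficient be read off the type, where a product with a numeral would unfold.
record _≤_scaled-by_ (a A s : ℕ) : Set where
  constructor scaled
  field
    scaled≤ : a ≤ A * s

open _≤_scaled-by_

module _ {l s : ℕ} (1≤l : 1 ≤ l) (s≡ : s ≡ l * l) where

  private
    infixr 6 _⊹_
    _⊹_ : ∀ {a b A B} → a ≤ A scaled-by s → b ≤ B scaled-by s → (a + b) ≤ (A + B) scaled-by s
    _⊹_ {A = A} {B} (scaled a≤) (scaled b≤) =
      scaled (≤-trans (+-mono-≤ a≤ b≤) (≤-reflexive (sym (*-distribʳ-+ s A B))))

    l≤s : l ≤ s
    l≤s = subst (l ≤_) (sym s≡) (m≤m*n l l {{>-nonZero 1≤l}})

    const : ∀ a → a ≤ a scaled-by s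
    const a = scaled (m≤m*n a s {{>-nonZero (≤-trans 1≤l l≤s)}})

  -- The inner loop contributes 14 + 7 = 21 and the rest of a row 2 + 20; with 14 for the outer loop
  -- this makes 57.
  scanCost≤ : ∀ {n} → n ≤ l → forCost n (rowCost n) ≤ 57 * s
  scanCost≤ {n} n≤l = begin
    forCost n (rowCost n)   ≤⟨ forCost≤ (rowCost n) n≤l 1≤l ⟩
    (14 + rowCost n) * l    ≤⟨ *-monoˡ-≤ l row ⟩
    57 * l * l              ≡⟨ *-assoc 57 l l ⟩
    57 * (l * l)            ≡⟨ cong (57 *_) s≡ ⟨
    57 * s                  ∎
    where
    open ≤-Reasoning
    row : 14 + rowCost n ≤ 57 * l
    row = begin
      16 + (forCost n 7 + 20)  ≤⟨ +-mono-≤ (scale 16) (+-mono-≤ (forCost≤ 7 n≤l 1≤l) (scale 20)) ⟩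
      16 * l + (21 * l + 20 * l) ≡⟨ cong (16 * l +_) (*-distribʳ-+ l 21 20) ⟨
      16 * l + 41 * l          ≡⟨ *-distribʳ-+ l 16 41 ⟨
      57 * l                   ∎
      where
      scale : ∀ a → a ≤ a * l
      scale a = m≤m*n a l {{>-nonZero 1≤l}}

  totalCost≤ : ∀ base size threshold stage {n} → n ≤ l →
    totalCost base size threshold (forCost n (rowCost n)) (forCost l stage) ≤
    totalCost base size threshold 57 (14 + stage) * s
  totalCost≤ base size threshold stage {n} n≤l = scaled≤ total
    where
    scanning : forCost n (rowCost n) ≤ 57 scaled-by s
    scanning = scaled (scanCost≤ n≤l)
    stages : forCost l stage ≤ (14 + stage) scaled-by s
    stages = scaled (≤-trans (forCost≤ stage ≤-refl 1≤l) (*-monoʳ-≤ (14 + stage) l≤s))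
    total : totalCost base size threshold (forCost n (rowCost n)) (forCost l stage) ≤
            totalCost base size threshold 57 (14 + stage) scaled-by s
    total = const 4 ⊹ scanning ⊹ const threshold ⊹ const 4 ⊹ const 2 ⊹ const base ⊹ const 2 ⊹
      const size ⊹ const 2 ⊹ stages ⊹ const 7

bound : ℕ → ℕ → ℕ
bound k t = totalCost (costBound baseT (kernelBound k t)) (costBound powT (sizeBound k t))
  (costBound thresholdT (kernelBound k t)) 57 (14 + stageCost (codeBound k t))

main-t : ∀ I → numVertices I < length (stacks I) →
  Terminates main (input I) (Decides I) (bound (numColours I) (threshold I) * length (stacks I) ^ 2)
main-t I n<l =
  let terminates r q b = hard-t I in
  terminates (⇓then (m>n⇒m∸n≢0 n<l) r) q
    (≤-trans (+-monoʳ-≤ 4 b)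
      (totalCost≤ (≤-trans (s≤s z≤n) n<l) (cong (length (stacks I) *_) (*-identityʳ (length (stacks I))))
        (costBound baseT (kernelBound k t)) (costBound powT (sizeBound k t))
        (costBound thresholdT (kernelBound k t)) (stageCost (codeBound k t)) (<⇒≤ n<l)))
  where
  k t : ℕ
  k = numColours I
  t = threshold I

theorem16 : Σ[ f ∈ (ℕ → ℕ → ℕ) ]
    DecidableInTimeO FittingHexasort
    (λ I → f (numColours I) (threshold I) * length (stacks I) ^ 2)
theorem16 = bound , main , 6 , decide
  where
  time : Instance → ℕ
  time I = bound (numColours I) (threshold I) * length (stacks I) ^ 2

  decide : ∀ I → ∃[ τ ] ∃[ m ] ⟨ main , input I ⟩⇓⟨ τ , m ⟩ × (Accepting τ ⇔ FittingHexasort I) ×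
           m ≤ 6 * (1 ⊔ time I)
  decide I with length (stacks I) ≤? numVertices I
  -- This branch determines the constant 6: 4 steps for the test and 2 for the assignment. It
  -- includes the case of no stacks, where only the maximum with 1 leaves any time.
  ... | yes l≤n = _ , _ , ⇓else (m≤n⇒m∸n≡0 l≤n) ⇓var ,
        accept I {input I} (placeable-few (graph I) (threshold I) (stacks I) 0 (λ _ _ → refl) l≤n) ,
        *-monoʳ-≤ 6 (m≤m⊔n 1 (time I))
  ... | no l≰n = let terminates r q b = main-t I (≰⇒> l≰n) in _ , _ , r , q ,
        ≤-trans b (≤-trans (m≤n⊔m 1 (time I)) (m≤n*m (1 ⊔ time I) 6))
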